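{- For every positive integer $\ell$, every graph $G$ and every $S\subseteq V(G)$: if $G$ has no $S$-rooted model of $P_\ell$, then $\operatorname{td}(G,S)\leq \binom{\ell}{2}$.
   Context: Graphs are finite and simple; the null graph is allowed (and is a rooted forest). $P_\ell$ is the path on $\ell$ vertices. A model of $H$ in $G$ is a family $(B_x\mid x\in V(H))$ of pairwise disjoint subsets of $V(G)$ such that each $G[B_x]$ is non-empty and connected and for every edge $xy\in E(H)$ there is an edge of $G$ between $B_x$ and $B_y$; it is $S$-rooted if $B_x\cap S\neq\emptyset$ for every $x\in V(H)$. For a rooted forest $F$, its closure is the graph on $V(F)$ where distinct $v,w$ are adjacent iff one is an ancestor of the other; $F$ is an elimination forest of a graph $H$ if $V(F)=V(H)$ and $H$ is a subgraph of the closure of $F$. The vertex-height of $F$ is the maximum number of vertices on a root-to-leaf path (0 for the null forest). An elimination forest of $(G,S)$ is an elimination forest $F$ of some induced subgraph $H$ of $G$ with $S\subseteq V(H)$ such that for every component $C$ of $G-V(H)$, either $V(C)$ has no neighbours in $G$ or some root-to-leaf path of $F$ contains all neighbours of $V(C)$ in $G$. $\operatorname{td}(G,S)$ is the minimum vertex-height of an elimination forest of $(G,S)$. -}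

module Defs where

open import Data.Nat using (ℕ; zero; suc; _≤_)
open import Data.Fin using (Fin; toℕ)
open import Data.Fin.Subset using (Subset; _∈_; _∉_)
open import Data.Bool using (Bool; true; false)
open import Data.Maybe using (Maybe; just; nothing)
open import Data.Product using (Σ; ∃; ∃-syntax; _×_; _,_)
open import Data.Sum using (_⊎_)
open import Relation.Binary.PropositionalEquality using (_≡_; _≢_)
open import Relation.Nullary using (¬_)

record Graph : Set where
  field
    n     : ℕ
    adj   : Fin n → Fin n → Bool
    sym   : ∀ u v → adj u v ≡ adj v u
    irref : ∀ v → adj v v ≡ false

open Graph public

module _ (G : Graph) where

  Adj : Fin (n G) → Fin (n G) → Set
  Adj u v = adj G u v ≡ true

  data Reach (X : Subset (n G)) (u : Fin (n G)) : Fin (n G) → Set where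
    here : u ∈ X → Reach X u u
    step : ∀ {v w} → Reach X u v → Adj v w → w ∈ X → Reach X u w

  Connected : Subset (n G) → Set
  Connected X = (∃[ v ] v ∈ X) × (∀ u v → u ∈ X → v ∈ X → Reach X u v)

  record RootedPathModel (S : Subset (n G)) (ℓ : ℕ) : Set where
    field
      B        : Fin ℓ → Subset (n G)
      disjoint : ∀ i j → i ≢ j → ∀ v → v ∈ B i → v ∉ B j
      conn     : ∀ i → Connected (B i)
      edges    : ∀ i j → toℕ j ≡ suc (toℕ i) →
                 ∃[ u ] ∃[ v ] (u ∈ B i × v ∈ B j × Adj u v)
      rooted   : ∀ i → ∃[ v ] (v ∈ B i × v ∈ S)

  module Forest (H : Subset (n G)) (parent : Fin (n G) → Maybe (Fin (n G))) where

    data Depth : Fin (n G) → ℕ → Set where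
      root : ∀ {v} → parent v ≡ nothing → Depth v 1
      up   : ∀ {v w d} → parent v ≡ just w → Depth w d → Depth v (suc d)

    data Anc : Fin (n G) → Fin (n G) → Set where
      par   : ∀ {v w} → parent v ≡ just w → Anc w v
      trans : ∀ {u v w} → Anc u v → parent u ≡ just w → Anc w v

    Leaf : Fin (n G) → Set
    Leaf v = v ∈ H × (∀ w → w ∈ H → parent w ≢ just v)

    -- parent is a rooted forest on H (parents lie in H; no cycles, i.e.
    -- every vertex of H has a finite chain of parents ending at a root)
    IsRootedForest : Set
    IsRootedForest = (∀ v w → v ∈ H → parent v ≡ just w → w ∈ H)
                   × (∀ v → v ∈ H → ∃[ d ] Depth v d)

    HeightAtMost : ℕ → Set
    HeightAtMost k = ∀ v d → v ∈ H → Depth v d → d ≤ k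

    ElimOfInduced : Set
    ElimOfInduced = ∀ u v → u ∈ H → v ∈ H → Adj u v → Anc u v ⊎ Anc v u

    IsComponentOutside : Subset (n G) → Set
    IsComponentOutside C =
        (∀ v → v ∈ C → v ∉ H)
      × Connected C
      × (∀ u v → u ∈ C → Adj u v → v ∉ H → v ∈ C)

    NbrOf : Subset (n G) → Fin (n G) → Set
    NbrOf C v = v ∉ C × ∃[ u ] (u ∈ C × Adj u v)

    ComponentCondition : Set
    ComponentCondition = ∀ C → IsComponentOutside C →
        (∀ v → ¬ NbrOf C v)
      ⊎ (∃[ x ] (Leaf x × (∀ v → NbrOf C v → v ≡ x ⊎ Anc v x)))

  record ElimForestOfHeight (S : Subset (n G)) (k : ℕ) : Set where
    field
      H      : Subset (n G)
      parent : Fin (n G) → Maybe (Fin (n G))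
    open Forest H parent
    field
      S⊆H      : ∀ v → v ∈ S → v ∈ H
      forest   : IsRootedForest
      elim     : ElimOfInduced
      comps    : ComponentCondition
      height   : HeightAtMost k

  -- td(G,S) ≤ k  (td is the minimum vertex-height, so this says some
  -- elimination forest of (G,S) has vertex-height ≤ k)
  td≤ : Subset (n G) → ℕ → Set
  td≤ S k = ElimForestOfHeight S k

{-# OPTIONS --safe #-}
module Submission where

-- Let k = ℓ − 1. By Menger's theorem, a path that cannot be separated from S by k vertices has
-- ℓ disjoint connections to S, and cutting it between their ends gives a model of P_ℓ; so every
-- path has a separator of at most k vertices. Call a set big if it contains a path that cannot
-- be separated from S inside the set by fewer than k vertices. In a connected graph two disjoint
-- big sets would combine to a path needing more than k vertices, so a depth-first search that
-- always enters the big component yields a path P meeting every big connected set. The at most k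
-- vertices separating P from S then meet every big connected set too. Put them on top of the
-- forest and recurse with k − 1 on what remains; the heights add up to k + (k − 1) + ⋯ + 1.

open import Defs
open import Algebra.Properties.CommutativeSemigroup using (interchange)
open import Data.Bool using (true; if_then_else_)
import Data.Bool.Properties as Bool
open import Data.Empty using (⊥-elim)
open import Data.Fin using (Fin; zero; suc; toℕ)
open import Data.Fin.Properties using (_≟_; any?; all?)
open import Data.Fin.Subset
open import Data.Fin.Subset.Properties
open import Data.List using (List; []; _∷_; allFin; filter; cartesianProduct)
open import Data.List.Membership.Propositional using () renaming (_∈_ to _∈ˡ_)
open import Data.List.Membership.Propositional.Properties
  using (∈-filter⁺; ∈-filter⁻; ∈-cartesianProduct⁺; ∈-allFin)
open import Data.List.Relation.Unary.Any using (here; there)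
open import Data.Maybe using (Maybe; just; nothing; fromMaybe)
open import Data.Maybe.Properties using () renaming (≡-dec to Maybe-≡-dec)
open import Data.Nat using (ℕ; zero; suc; _+_; _≤_; _<_; z≤n; s≤s; s≤s⁻¹; _<?_)
open import Data.Nat.Combinatorics using (_C_; nCk+nC[k+1]≡[n+1]C[k+1]; nC1≡n)
open import Data.Nat.Properties hiding (_≟_)
open import Data.Product using (∃; ∃-syntax; _×_; _,_; proj₁; proj₂)
open import Data.Sum using (_⊎_; inj₁; inj₂; [_,_]′)
open import Data.Vec using ([]; _∷_; here; there; tabulate)
open import Data.Vec.Properties using (lookup∘tabulate; []=⇒lookup; lookup⇒[]=; ≡-dec)
open import Function using (_∘_; id)
open import Relation.Binary.PropositionalEquality
  using (_≡_; _≢_; refl; trans; cong; subst) renaming (sym to ≡-sym)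
open import Relation.Nullary using (¬_; Dec; yes; no; does; contradiction)
open import Relation.Nullary.Decidable
  using (map′; ¬?; _×-dec_; _⊎-dec_; _→-dec_; dec-true; dec-false)
open import Relation.Unary using () renaming (Decidable to Decidable₁)

-- Menger's theorem is used only for the whole graph. From then on the recursion carries `Flat`, a
-- statement about separators: it passes to subsets for free, and separators, unlike models, can be
-- uncrossed. Two disjoint big sets are impossible for the following reason. Their paths are
-- recombined through a connecting path in two ways. Inside either big set, the separators of the
-- two new paths cut off two halves that share a vertex, and submodularity merges them into a
-- separator of the whole big path with one vertex fewer than they have together. Without this saved
-- vertex the count would only balance. Meeting P is enough for the following reason. A big
-- connected set avoiding the separator Y still reaches S; if it met P, it would join P to S around
-- Y, and if it missed P, it would be big in the complement of P, where the search has left nothing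
-- big. So deleting Y lowers the bound on separators by one.

-- Sizes of finite subsets

x∈p─q⇒x∉q : ∀ {m} {x : Fin m} (p q : Subset m) → x ∈ p ─ q → x ∉ q
x∈p─q⇒x∉q (_ ∷ p) (_ ∷ q) (there x∈) (there x∈q) = x∈p─q⇒x∉q p q x∈ x∈q

x∉p-x : ∀ {m} {x : Fin m} (p : Subset m) → x ∉ p - x
x∉p-x {x = x} p x∈ = x∈p─q⇒x∉q p ⁅ x ⁆ x∈ (x∈⁅x⁆ x)

∣p∪q∣≤∣p∣+∣q∣ : ∀ {m} (p q : Subset m) → ∣ p ∪ q ∣ ≤ ∣ p ∣ + ∣ q ∣
∣p∪q∣≤∣p∣+∣q∣ []            []            = z≤n
∣p∪q∣≤∣p∣+∣q∣ (outside ∷ p) (outside ∷ q) = ∣p∪q∣≤∣p∣+∣q∣ p q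
∣p∪q∣≤∣p∣+∣q∣ (outside ∷ p) (inside  ∷ q) =
  ≤-trans (s≤s (∣p∪q∣≤∣p∣+∣q∣ p q)) (≤-reflexive (≡-sym (+-suc ∣ p ∣ ∣ q ∣)))
∣p∪q∣≤∣p∣+∣q∣ (inside  ∷ p) (outside ∷ q) = s≤s (∣p∪q∣≤∣p∣+∣q∣ p q)
∣p∪q∣≤∣p∣+∣q∣ (inside  ∷ p) (inside  ∷ q) =
  s≤s (≤-trans (∣p∪q∣≤∣p∣+∣q∣ p q) (+-monoʳ-≤ ∣ p ∣ (n≤1+n ∣ q ∣)))

∣p∪⁅x⁆∣≤1+∣p∣ : ∀ {m} (p : Subset m) x → ∣ p ∪ ⁅ x ⁆ ∣ ≤ suc ∣ p ∣
∣p∪⁅x⁆∣≤1+∣p∣ p x = ≤-trans (∣p∪q∣≤∣p∣+∣q∣ p ⁅ x ⁆)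
  (≤-reflexive (trans (cong (∣ p ∣ +_) (∣⁅x⁆∣≡1 x)) (+-comm ∣ p ∣ 1)))

∣p∩q∣+∣p∩r∣≤∣p∣ : ∀ {m} (p q r : Subset m) → (∀ {x} → x ∈ q → x ∉ r) →
                 ∣ p ∩ q ∣ + ∣ p ∩ r ∣ ≤ ∣ p ∣
∣p∩q∣+∣p∩r∣≤∣p∣ []            []            []            dis = z≤n
∣p∩q∣+∣p∩r∣≤∣p∣ (outside ∷ p) (_ ∷ q)       (_ ∷ r)       dis =
  ∣p∩q∣+∣p∩r∣≤∣p∣ p q r (λ x∈q x∈r → dis (there x∈q) (there x∈r))
∣p∩q∣+∣p∩r∣≤∣p∣ (inside ∷ p)  (inside ∷ q)  (inside ∷ r)  dis = ⊥-elim (dis here here)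
∣p∩q∣+∣p∩r∣≤∣p∣ (inside ∷ p)  (inside ∷ q)  (outside ∷ r) dis =
  s≤s (∣p∩q∣+∣p∩r∣≤∣p∣ p q r (λ x∈q x∈r → dis (there x∈q) (there x∈r)))
∣p∩q∣+∣p∩r∣≤∣p∣ (inside ∷ p)  (outside ∷ q) (outside ∷ r) dis =
  m≤n⇒m≤1+n (∣p∩q∣+∣p∩r∣≤∣p∣ p q r (λ x∈q x∈r → dis (there x∈q) (there x∈r)))
∣p∩q∣+∣p∩r∣≤∣p∣ (inside ∷ p)  (outside ∷ q) (inside ∷ r)  dis =
  ≤-trans (≤-reflexive (+-suc ∣ p ∩ q ∣ ∣ p ∩ r ∣))
          (s≤s (∣p∩q∣+∣p∩r∣≤∣p∣ p q r (λ x∈q x∈r → dis (there x∈q) (there x∈r))))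

p-x∪⁅x⁆≡p : ∀ {m} {p : Subset m} {x} → x ∈ p → (p - x) ∪ ⁅ x ⁆ ≡ p
p-x∪⁅x⁆≡p {p = p} {x} x∈p = ⊆-antisym
  (λ z∈ → [ p─q⊆p p ⁅ x ⁆ , (λ z∈x → subst (_∈ p) (≡-sym (x∈⁅y⁆⇒x≡y x z∈x)) x∈p) ]′ (x∈p∪q⁻ (p - x) ⁅ x ⁆ z∈))
  back
  where
  back : p ⊆ (p - x) ∪ ⁅ x ⁆
  back {z} z∈p with z ≟ x
  ... | yes refl = q⊆p∪q (p - x) ⁅ x ⁆ (x∈⁅x⁆ x)
  ... | no  z≢x  = p⊆p∪q ⁅ x ⁆ (x∈p∧x≢y⇒x∈p-y z∈p z≢x)
-- Menger's theorem

module Menger {N : ℕ} where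

  Arcs : Set
  Arcs = List (Fin N × Fin N)

  -- P is required of all vertices of the walk but the last.
  data To (E : Arcs) (P : Fin N → Set) (a : Fin N) : Fin N → Set where
    start : To E P a a
    step  : ∀ {u v} → To E P a u → P u → (u , v) ∈ˡ E → To E P a v

  -- P is required of all vertices of the walk but the first.
  data From (E : Arcs) (P : Fin N → Set) : Fin N → Fin N → Set where
    stop : ∀ {b} → From E P b b
    step : ∀ {u v b} → (u , v) ∈ˡ E → P v → From E P v b → From E P u b

  -- A positive form of meeting every walk: `To` puts no condition on the last vertex, so a walk
  -- that avoids `Y` up to there is forced to end in `Y`.
  Sep : Arcs → Subset N → Subset N → Subset N → Set
  Sep E Y A B = ∀ {a b} → a ∈ A → b ∈ B → To E (_∉ Y) a b → b ∈ Y

  To-map : ∀ {E P Q a b} → (∀ {u} → P u → Q u) → To E P a b → To E Q a b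
  To-map f start        = start
  To-map f (step t p e) = step (To-map f t) (f p) e

  From-map : ∀ {E P Q a b} → (∀ {u} → P u → Q u) → From E P a b → From E Q a b
  From-map f stop         = stop
  From-map f (step e p t) = step e (f p) (From-map f t)

  To-weaken : ∀ {e E P a b} → To E P a b → To (e ∷ E) P a b
  To-weaken start        = start
  To-weaken (step t p e) = step (To-weaken t) p (there e)

  From-weaken : ∀ {e E P a b} → From E P a b → From (e ∷ E) P a b
  From-weaken stop         = stop
  From-weaken (step e p t) = step (there e) p (From-weaken t)

  _++ᵗ_ : ∀ {E P a b c} → To E P a b → To E P b c → To E P a c
  s ++ᵗ start      = s
  s ++ᵗ step t p e = step (s ++ᵗ t) p e

  _++ᶠ_ : ∀ {E P a b c} → From E P a b → From E P b c → From E P a c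
  stop       ++ᶠ t = t
  step e p s ++ᶠ t = step e p (s ++ᶠ t)

  To++From : ∀ {E P a b c} → To E P a b → P b → From E P b c → To E P a c × P c
  To++From s p stop         = s , p
  To++From s p (step e q t) = To++From (step s p e) q t

  -- Disjoint A–B paths of which only the vertex sets (leg) and both ends are kept; pre and suf
  -- walk along a leg from its start and to its end.
  record Linkage (E : Arcs) (A B : Subset N) (k : ℕ) : Set where
    field
      starts   : Subset N
      size     : k ≤ ∣ starts ∣
      starts⊆A : starts ⊆ A
      leg      : Fin N → Subset N
      end      : Fin N → Fin N
      a∈leg    : ∀ {a} → a ∈ starts → a ∈ leg a
      end∈leg  : ∀ {a} → a ∈ starts → end a ∈ leg a
      end∈B    : ∀ {a} → a ∈ starts → end a ∈ B
      onlyA    : ∀ {a z} → a ∈ starts → z ∈ leg a → z ∈ A → z ≡ a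
      onlyB    : ∀ {a z} → a ∈ starts → z ∈ leg a → z ∈ B → z ≡ end a
      pre      : ∀ {a z} → a ∈ starts → z ∈ leg a → To E (λ u → u ∈ leg a × u ∉ B) a z
      suf      : ∀ {a z} → a ∈ starts → z ∈ leg a → From E (λ u → u ∈ leg a × u ∉ A) z (end a)
      disjoint : ∀ {a b z} → a ∈ starts → b ∈ starts → z ∈ leg a → z ∈ leg b → a ≡ b

  Linkage-weaken : ∀ {e E A B k} → Linkage E A B k → Linkage (e ∷ E) A B k
  Linkage-weaken L = record
    { starts = starts ; size = size ; starts⊆A = starts⊆A ; leg = leg ; end = end
    ; a∈leg = a∈leg ; end∈leg = end∈leg ; end∈B = end∈B ; onlyA = onlyA ; onlyB = onlyB
    ; pre = λ a∈ z∈ → To-weaken (pre a∈ z∈) ; suf = λ a∈ z∈ → From-weaken (suf a∈ z∈)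
    ; disjoint = disjoint }
    where open Linkage L

  trivialLinkage : ∀ {A B k} → k ≤ ∣ A ∩ B ∣ → Linkage [] A B k
  trivialLinkage {A} {B} k≤ = record
    { starts = A ∩ B ; size = k≤ ; starts⊆A = p∩q⊆p A B ; leg = ⁅_⁆ ; end = λ a → a
    ; a∈leg = λ {a} _ → x∈⁅x⁆ a ; end∈leg = λ {a} _ → x∈⁅x⁆ a ; end∈B = p∩q⊆q A B
    ; onlyA = λ _ z∈ _ → x∈⁅y⁆⇒x≡y _ z∈ ; onlyB = λ _ z∈ _ → x∈⁅y⁆⇒x≡y _ z∈
    ; pre = λ {a} _ z∈ → subst (To [] _ a) (≡-sym (x∈⁅y⁆⇒x≡y a z∈)) start
    ; suf = λ {a} _ z∈ → subst (λ z → From [] _ z a) (≡-sym (x∈⁅y⁆⇒x≡y a z∈)) stop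
    ; disjoint = λ _ _ z∈a z∈b → trans (≡-sym (x∈⁅y⁆⇒x≡y _ z∈a)) (x∈⁅y⁆⇒x≡y _ z∈b) }

  Sep-tail-or-head∈ : ∀ {E A B x y Y} → x ∈ Y ⊎ y ∈ Y → Sep E Y A B → Sep ((x , y) ∷ E) Y A B
  Sep-tail-or-head∈ {E} {x = x} {y} {Y} xy sep {a} a∈ b∈ t = [ (λ p → p) , sep a∈ b∈ ]′ (go t)
    where
    go : ∀ {v} → To ((x , y) ∷ E) (_∉ Y) a v → v ∈ Y ⊎ To E (_∉ Y) a v
    go start = inj₂ start
    go (step t u∉ e) with go t
    go (step t u∉ e)           | inj₁ u∈ = contradiction u∈ u∉
    go (step t u∉ (there e))   | inj₂ s  = inj₂ (step s u∉ e)
    go (step t u∉ (here refl)) | inj₂ s  = [ (λ x∈ → contradiction x∈ u∉) , inj₁ ]′ xy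

  -- The new arc leaves `x`, so up to its first vertex in `Y ∪ ⁅ x ⁆` a walk uses only arcs of `E`.
  -- A walk that uses only `E` throughout ends in `Y` or meets it earlier, by `sepY`.
  Sep-before : ∀ {E A B x y Y Z} → Sep E Y A B → Sep E Z A (Y ∪ ⁅ x ⁆) → Sep ((x , y) ∷ E) Z A B
  Sep-before {E} {x = x} {y} {Y} {Z} sepY sepZ {a} a∈ b∈ t =
    [ (λ { (w , w∈ , s , w∉Z) → contradiction (sepZ a∈ w∈ s) w∉Z })
    , (λ s → sepZ a∈ (p⊆p∪q ⁅ x ⁆ (sepY a∈ b∈ (To-map proj₂ s))) (To-map proj₁ s)) ]′ (go t)
    where
    go : ∀ {v} → To ((x , y) ∷ E) (_∉ Z) a v →
         (∃[ w ] w ∈ Y ∪ ⁅ x ⁆ × To E (_∉ Z) a w × w ∉ Z) ⊎ To E (λ u → u ∉ Z × u ∉ Y) a v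
    go start = inj₂ start
    go (step {u} t u∉Z e) with go t
    ... | inj₁ r = inj₁ r
    ... | inj₂ s with u ∈? (Y ∪ ⁅ x ⁆)
    ...   | yes u∈ = inj₁ (u , u∈ , To-map proj₁ s , u∉Z)
    go (step t u∉Z (here refl)) | inj₂ s | no u∉ = contradiction (q⊆p∪q Y ⁅ x ⁆ (x∈⁅x⁆ x)) u∉
    go (step t u∉Z (there e))   | inj₂ s | no u∉ = inj₂ (step s (u∉Z , u∉ ∘ p⊆p∪q ⁅ x ⁆) e)

  -- Mirror image of `Sep-before`: `Reached` keeps the part of the walk since its last vertex in
  -- `Y ∪ ⁅ y ⁆`, and the new arc, which ends in `y`, never occurs in that part.
  Sep-after : ∀ {E A B x y Y Z} → Sep E Y A B → Sep E Z (Y ∪ ⁅ y ⁆) B → Sep ((x , y) ∷ E) Z A B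
  Sep-after {E} {x = x} {y} {Y} {Z} sepY sepZ {a} a∈ b∈ t =
    [ (λ { (w , w∈ , s) → sepZ w∈ b∈ s })
    , (λ { (s , b∉) → contradiction (p⊆p∪q ⁅ y ⁆ (sepY a∈ b∈ s)) b∉ }) ]′ (go t)
    where
    Reached : Fin N → Set
    Reached v = (∃[ w ] w ∈ Y ∪ ⁅ y ⁆ × To E (_∉ Z) w v) ⊎ (To E (_∉ Y) a v × v ∉ Y ∪ ⁅ y ⁆)
    go : ∀ {v} → To ((x , y) ∷ E) (_∉ Z) a v → Reached v
    extend : ∀ {u v} → Reached u → u ∉ Z → (u , v) ∈ˡ ((x , y) ∷ E) → v ∉ Y ∪ ⁅ y ⁆ → Reached v
    extend r u∉ (here refl) v∉ = contradiction (q⊆p∪q Y ⁅ y ⁆ (x∈⁅x⁆ y)) v∉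
    extend (inj₁ (w , w∈ , s)) u∉ (there e) v∉ = inj₁ (w , w∈ , step s u∉ e)
    extend (inj₂ (s , u∉Y))    u∉ (there e) v∉ = inj₂ (step s (u∉Y ∘ p⊆p∪q ⁅ y ⁆) e , v∉)
    go start with a ∈? (Y ∪ ⁅ y ⁆)
    ... | yes a∈ = inj₁ (a , a∈ , start)
    ... | no  a∉ = inj₂ (start , a∉)
    go (step {v = v} t u∉ e) with v ∈? (Y ∪ ⁅ y ⁆)
    ... | yes v∈ = inj₁ (v , v∈ , start)
    ... | no  v∉ = extend (go t) u∉ e v∉

  module Join {E : Arcs} {A B : Subset N} {k : ℕ} {x y : Fin N} {Y : Subset N}
              (∣Y∣<k : ∣ Y ∣ < k) (sep : Sep E Y A B) (x∉Y : x ∉ Y) (y∉Y : y ∉ Y)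
              (L₁ : Linkage E A (Y ∪ ⁅ x ⁆) k) (L₂ : Linkage E (Y ∪ ⁅ y ⁆) B k) where

    module L₁ = Linkage L₁
    module L₂ = Linkage L₂

    Y⊆Y∪y : Y ⊆ Y ∪ ⁅ y ⁆
    Y⊆Y∪y = p⊆p∪q ⁅ y ⁆

    y∈Y∪y : y ∈ Y ∪ ⁅ y ⁆
    y∈Y∪y = q⊆p∪q Y ⁅ y ⁆ (x∈⁅x⁆ y)

    -- `L₂` has at least `k` starts in a set of at most `k` vertices. Hence every leg of `L₁` finds
    -- a leg of `L₂` to continue it.
    starts₂-full : Y ∪ ⁅ y ⁆ ⊆ L₂.starts
    starts₂-full {w} w∈ with w ∈? L₂.starts
    ... | yes w∈s = w∈s
    ... | no  w∉s = contradiction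
      (≤-trans (s≤s L₂.size) (≤-trans (p⊂q⇒∣p∣<∣q∣ (L₂.starts⊆A , w , w∈ , w∉s)) (∣p∪⁅x⁆∣≤1+∣p∣ Y y)))
      (<⇒≱ (s≤s ∣Y∣<k))

    -- A leg ending in `x` crosses the deleted arc; a leg ending in `Y` is continued where it ends.
    hop : Fin N → Fin N
    hop w with w ≟ x
    ... | yes _ = y
    ... | no  _ = w

    hop∈ : ∀ {w} → w ∈ Y ∪ ⁅ x ⁆ → hop w ∈ Y ∪ ⁅ y ⁆
    hop∈ {w} w∈ with w ≟ x
    ... | yes _  = y∈Y∪y
    ... | no w≢x = [ Y⊆Y∪y , (λ w∈x → contradiction (x∈⁅y⁆⇒x≡y x w∈x) w≢x) ]′ (x∈p∪q⁻ Y ⁅ x ⁆ w∈)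

    hop∈Y⇒fixed : ∀ {w} → hop w ∈ Y → hop w ≡ w
    hop∈Y⇒fixed {w} h∈ with w ≟ x
    ... | yes _ = contradiction h∈ y∉Y
    ... | no  _ = refl

    w∈Y⇒hop≡w : ∀ {w} → w ∈ Y → hop w ≡ w
    w∈Y⇒hop≡w {w} w∈ with w ≟ x
    ... | yes refl = contradiction w∈ x∉Y
    ... | no  _ = refl

    hop-injective : ∀ {v w} → v ∈ Y ∪ ⁅ x ⁆ → w ∈ Y ∪ ⁅ x ⁆ → hop v ≡ hop w → v ≡ w
    hop-injective {v} {w} v∈ w∈ eq with v ≟ x | w ≟ x
    ... | yes refl | yes refl = refl
    ... | no _     | no _     = eq
    ... | yes refl | no w≢x   = [ (λ w∈Y → contradiction (subst (_∈ Y) (≡-sym eq) w∈Y) y∉Y)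
                                , (λ w∈x → contradiction (x∈⁅y⁆⇒x≡y x w∈x) w≢x) ]′ (x∈p∪q⁻ Y ⁅ x ⁆ w∈)
    ... | no v≢x   | yes refl = [ (λ v∈Y → contradiction (subst (_∈ Y) eq v∈Y) y∉Y)
                                , (λ v∈x → contradiction (x∈⁅y⁆⇒x≡y x v∈x) v≢x) ]′ (x∈p∪q⁻ Y ⁅ x ⁆ v∈)

    hop-To : ∀ {P a w} → (w ∉ Y → P w) → To ((x , y) ∷ E) P a w → To ((x , y) ∷ E) P a (hop w)
    hop-To {w = w} p t with w ≟ x
    ... | yes refl = step t (p x∉Y) (here refl)
    ... | no  _    = t

    hop-From : ∀ {P w} → (hop w ∉ Y → P (hop w)) → From ((x , y) ∷ E) P w (hop w)
    hop-From {w = w} p with w ≟ x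
    ... | yes refl = step (here refl) (p y∉Y) stop
    ... | no  _    = stop

    next : Fin N → Fin N
    next a = hop (L₁.end a)

    next∈ : ∀ {a} → a ∈ L₁.starts → next a ∈ Y ∪ ⁅ y ⁆
    next∈ a∈ = hop∈ (L₁.end∈B a∈)

    next∈starts : ∀ {a} → a ∈ L₁.starts → next a ∈ L₂.starts
    next∈starts a∈ = starts₂-full (next∈ a∈)

    -- Here it matters that `pre` avoids the target set before `u`: the walk from `a` avoids `Y`
    -- until `u`, so `sep` would force a vertex `u` of `B` into `Y`.
    leg₁∉B : ∀ {a u} → a ∈ L₁.starts → u ∈ L₁.leg a → u ∉ Y → u ∉ B
    leg₁∉B a∈ u∈ u∉Y u∈B = u∉Y (sep (L₁.starts⊆A a∈) u∈B
      (To-map (λ { (_ , ∉Yx) → ∉Yx ∘ p⊆p∪q ⁅ x ⁆ }) (L₁.pre a∈ u∈)))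

    from₂ : ∀ {b u} → b ∈ Y ∪ ⁅ y ⁆ → u ∈ L₂.leg b → From E (_∉ Y) u (L₂.end b)
    from₂ b∈ u∈ = From-map (λ { (_ , ∉Yy) → ∉Yy ∘ Y⊆Y∪y }) (L₂.suf (starts₂-full b∈) u∈)

    leg₂∉A : ∀ {b u} → b ∈ Y ∪ ⁅ y ⁆ → u ∈ L₂.leg b → u ∉ Y → u ∉ A
    leg₂∉A b∈ u∈ u∉Y u∈A with To++From start u∉Y (from₂ b∈ u∈)
    ... | t , end∉Y = end∉Y (sep u∈A (L₂.end∈B (starts₂-full b∈)) t)

    -- At a common vertex outside `Y`, the beginning of one leg and the remainder of the other would
    -- form a walk in `E` from `A` to `B` around `Y`.
    cross : ∀ {a b z} → a ∈ L₁.starts → b ∈ Y ∪ ⁅ y ⁆ → z ∈ L₁.leg a → z ∈ L₂.leg b → z ≡ b × z ∈ Y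
    cross {z = z} a∈ b∈ z∈₁ z∈₂ with z ∈? Y
    ... | yes z∈Y = L₂.onlyA (starts₂-full b∈) z∈₂ (Y⊆Y∪y z∈Y) , z∈Y
    ... | no  z∉Y with To++From (To-map (λ { (_ , ∉Yx) → ∉Yx ∘ p⊆p∪q ⁅ x ⁆ }) (L₁.pre a∈ z∈₁)) z∉Y (from₂ b∈ z∈₂)
    ...   | t , end∉Y = contradiction (sep (L₁.starts⊆A a∈) (L₂.end∈B (starts₂-full b∈)) t) end∉Y

    legs : Fin N → Subset N
    legs a = L₁.leg a ∪ L₂.leg (next a)

    ∈₁ : ∀ {a z} → z ∈ L₁.leg a → z ∈ legs a
    ∈₁ {a} = p⊆p∪q (L₂.leg (next a))

    ∈₂ : ∀ {a z} → z ∈ L₂.leg (next a) → z ∈ legs a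
    ∈₂ {a} = q⊆p∪q (L₁.leg a) (L₂.leg (next a))

    split : ∀ {a z} → z ∈ legs a → z ∈ L₁.leg a ⊎ z ∈ L₂.leg (next a)
    split {a} = x∈p∪q⁻ (L₁.leg a) (L₂.leg (next a))

    next∈leg₂ : ∀ {a} → a ∈ L₁.starts → next a ∈ L₂.leg (next a)
    next∈leg₂ a∈ = L₂.a∈leg (next∈starts a∈)

    onlyA′ : ∀ {a z} → a ∈ L₁.starts → z ∈ legs a → z ∈ A → z ≡ a
    onlyA′ {a} {z} a∈ z∈ z∈A with split z∈
    ... | inj₁ z∈₁ = L₁.onlyA a∈ z∈₁ z∈A
    ... | inj₂ z∈₂ with z ∈? Y
    ...   | no  z∉Y = contradiction z∈A (leg₂∉A (next∈ a∈) z∈₂ z∉Y)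
    ...   | yes z∈Y = L₁.onlyA a∈ (subst (_∈ L₁.leg a) (≡-sym z≡end) (L₁.end∈leg a∈)) z∈A
      where
      z≡next : z ≡ next a
      z≡next = L₂.onlyA (next∈starts a∈) z∈₂ (Y⊆Y∪y z∈Y)
      z≡end : z ≡ L₁.end a
      z≡end = trans z≡next (hop∈Y⇒fixed (subst (_∈ Y) z≡next z∈Y))

    onlyB′ : ∀ {a z} → a ∈ L₁.starts → z ∈ legs a → z ∈ B → z ≡ L₂.end (next a)
    onlyB′ {a} {z} a∈ z∈ z∈B with split z∈
    ... | inj₂ z∈₂ = L₂.onlyB (next∈starts a∈) z∈₂ z∈B
    ... | inj₁ z∈₁ with z ∈? Y
    ...   | no  z∉Y = contradiction z∈B (leg₁∉B a∈ z∈₁ z∉Y)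
    ...   | yes z∈Y = L₂.onlyB (next∈starts a∈) (subst (_∈ L₂.leg (next a)) (≡-sym z≡next) (next∈leg₂ a∈)) z∈B
      where
      z≡end : z ≡ L₁.end a
      z≡end = L₁.onlyB a∈ z∈₁ (p⊆p∪q ⁅ x ⁆ z∈Y)
      z≡next : z ≡ next a
      z≡next = trans z≡end (≡-sym (w∈Y⇒hop≡w (subst (_∈ Y) z≡end z∈Y)))

    pre′ : ∀ {a z} → a ∈ L₁.starts → z ∈ legs a → To ((x , y) ∷ E) (λ u → u ∈ legs a × u ∉ B) a z
    pre′ {a} {z} a∈ z∈ = [ pre₁ , (λ z∈₂ → toNext ++ᵗ pre₂ z∈₂) ]′ (split z∈)
      where
      Good : Fin N → Set
      Good u = u ∈ legs a × u ∉ B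
      pre₁ : ∀ {u} → u ∈ L₁.leg a → To ((x , y) ∷ E) Good a u
      pre₁ u∈ = To-weaken (To-map (λ { (v∈ , v∉) → ∈₁ v∈ , leg₁∉B a∈ v∈ (v∉ ∘ p⊆p∪q ⁅ x ⁆) }) (L₁.pre a∈ u∈))
      pre₂ : ∀ {u} → u ∈ L₂.leg (next a) → To ((x , y) ∷ E) Good (next a) u
      pre₂ u∈ = To-weaken (To-map (λ { (v∈ , v∉) → ∈₂ v∈ , v∉ }) (L₂.pre (next∈starts a∈) u∈))
      toNext : To ((x , y) ∷ E) Good a (next a)
      toNext = hop-To (λ ∉Y → ∈₁ end∈ , leg₁∉B a∈ end∈ ∉Y) (pre₁ end∈)
        where
        end∈ : L₁.end a ∈ L₁.leg a
        end∈ = L₁.end∈leg a∈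

    suf′ : ∀ {a z} → a ∈ L₁.starts → z ∈ legs a →
           From ((x , y) ∷ E) (λ u → u ∈ legs a × u ∉ A) z (L₂.end (next a))
    suf′ {a} {z} a∈ z∈ = [ (λ z∈₁ → suf₁ z∈₁ ++ᶠ (toNext ++ᶠ suf₂ (next∈leg₂ a∈))) , suf₂ ]′ (split z∈)
      where
      Good : Fin N → Set
      Good u = u ∈ legs a × u ∉ A
      suf₁ : ∀ {u} → u ∈ L₁.leg a → From ((x , y) ∷ E) Good u (L₁.end a)
      suf₁ u∈ = From-weaken (From-map (λ { (v∈ , v∉) → ∈₁ v∈ , v∉ }) (L₁.suf a∈ u∈))
      suf₂ : ∀ {u} → u ∈ L₂.leg (next a) → From ((x , y) ∷ E) Good u (L₂.end (next a))
      suf₂ u∈ = From-weaken (From-map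
        (λ { (v∈ , v∉) → ∈₂ v∈ , leg₂∉A (next∈ a∈) v∈ (v∉ ∘ Y⊆Y∪y) }) (L₂.suf (next∈starts a∈) u∈))
      toNext : From ((x , y) ∷ E) Good (L₁.end a) (next a)
      toNext = hop-From (λ ∉Y → ∈₂ (next∈leg₂ a∈) , leg₂∉A (next∈ a∈) (next∈leg₂ a∈) ∉Y)

    disjoint′ : ∀ {a b z} → a ∈ L₁.starts → b ∈ L₁.starts → z ∈ legs a → z ∈ legs b → a ≡ b
    disjoint′ {a} {b} {z} a∈ b∈ z∈a z∈b with split z∈a | split z∈b
    ... | inj₁ p | inj₁ q = L₁.disjoint a∈ b∈ p q
    ... | inj₂ p | inj₂ q = L₁.disjoint a∈ b∈ (L₁.end∈leg a∈)
            (subst (_∈ L₁.leg b) (≡-sym ends) (L₁.end∈leg b∈))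
      where
      ends : L₁.end a ≡ L₁.end b
      ends = hop-injective (L₁.end∈B a∈) (L₁.end∈B b∈) (L₂.disjoint (next∈starts a∈) (next∈starts b∈) p q)
    ... | inj₁ p | inj₂ q = L₁.disjoint a∈ b∈ p (meets a∈ b∈ p q)
      where
      meets : ∀ {a b z} → a ∈ L₁.starts → b ∈ L₁.starts → z ∈ L₁.leg a → z ∈ L₂.leg (next b) → z ∈ L₁.leg b
      meets {b = b} a∈ b∈ p q with cross a∈ (next∈ b∈) p q
      ... | refl , z∈Y = subst (_∈ L₁.leg b) (≡-sym (hop∈Y⇒fixed z∈Y)) (L₁.end∈leg b∈)
    ... | inj₂ p | inj₁ q with cross b∈ (next∈ a∈) q p
    ...   | refl , z∈Y = L₁.disjoint a∈ b∈ (subst (_∈ L₁.leg a) (≡-sym (hop∈Y⇒fixed z∈Y)) (L₁.end∈leg a∈)) q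

    join : Linkage ((x , y) ∷ E) A B k
    join = record
      { starts = L₁.starts ; size = L₁.size ; starts⊆A = L₁.starts⊆A ; leg = legs
      ; end = λ a → L₂.end (next a)
      ; a∈leg = λ a∈ → ∈₁ (L₁.a∈leg a∈)
      ; end∈leg = λ a∈ → ∈₂ (L₂.end∈leg (next∈starts a∈))
      ; end∈B = λ a∈ → L₂.end∈B (next∈starts a∈)
      ; onlyA = onlyA′ ; onlyB = onlyB′ ; pre = pre′ ; suf = suf′ ; disjoint = disjoint′ }

  -- Göring's proof of Menger's theorem: delete the arc (x , y); if Y separates A from B
  -- without it, then both Y ∪ {x} and Y ∪ {y} are separators of the full digraph.
  menger : ∀ E A B k → (∃[ Y ] ∣ Y ∣ < k × Sep E Y A B) ⊎ Linkage E A B k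
  menger [] A B k with <-≤-connex ∣ A ∩ B ∣ k
  ... | inj₁ small = inj₁ (A ∩ B , small , λ { a∈ b∈ start → x∈p∩q⁺ (a∈ , b∈) })
  ... | inj₂ large = inj₂ (trivialLinkage large)
  menger ((x , y) ∷ E) A B k with menger E A B k
  ... | inj₂ L = inj₂ (Linkage-weaken L)
  ... | inj₁ (Y , ∣Y∣<k , sep) with x ∈? Y | y ∈? Y
  ...   | yes x∈ | _      = inj₁ (Y , ∣Y∣<k , Sep-tail-or-head∈ (inj₁ x∈) sep)
  ...   | no _   | yes y∈ = inj₁ (Y , ∣Y∣<k , Sep-tail-or-head∈ (inj₂ y∈) sep)
  ...   | no x∉  | no y∉ with menger E A (Y ∪ ⁅ x ⁆) k
  ...     | inj₁ (Z , ∣Z∣<k , sepZ) = inj₁ (Z , ∣Z∣<k , Sep-before sep sepZ)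
  ...     | inj₂ L₁ with menger E (Y ∪ ⁅ y ⁆) B k
  ...       | inj₁ (Z , ∣Z∣<k , sepZ) = inj₁ (Z , ∣Z∣<k , Sep-after sep sepZ)
  ...       | inj₂ L₂ = inj₂ (Join.join ∣Y∣<k sep x∉ y∉ L₁ L₂)

module _ (G : Graph) (S : Subset (n G)) where

  -- Reachability, paths and separators

  V : Set
  V = Fin (n G)

  R : Subset (n G) → V → V → Set
  R = Reach G

  _~_ : V → V → Set
  _~_ = Adj G

  ~-sym : ∀ {u v} → u ~ v → v ~ u
  ~-sym {u} {v} e = trans (sym G v u) e

  _~?_ : ∀ u v → Dec (u ~ v)
  u ~? v = adj G u v Bool.≟ true

  ∈─ : ∀ {X Y : Subset (n G)} {v} → v ∈ X → v ∉ Y → v ∈ X ─ Y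
  ∈─ = x∈p∧x∉q⇒x∈p─q

  ─⁻ : ∀ {X Y : Subset (n G)} {v} → v ∈ X ─ Y → v ∈ X × v ∉ Y
  ─⁻ {X} {Y} v∈ = p─q⊆p X Y v∈ , x∈p─q⇒x∉q X Y v∈

  ─-mono : ∀ {X X′ Y Y′ : Subset (n G)} → X ⊆ X′ → Y′ ⊆ Y → X ─ Y ⊆ X′ ─ Y′
  ─-mono X⊆ Y⊇ v∈ = ∈─ (X⊆ (proj₁ (─⁻ v∈))) (proj₂ (─⁻ v∈) ∘ Y⊇)

  R-target : ∀ {X u v} → R X u v → v ∈ X
  R-target (here u∈)     = u∈
  R-target (step _ _ v∈) = v∈

  R-source : ∀ {X u v} → R X u v → u ∈ X
  R-source (here u∈)    = u∈
  R-source (step r _ _) = R-source r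

  R-mono : ∀ {X Y u v} → X ⊆ Y → R X u v → R Y u v
  R-mono X⊆Y (here u∈)     = here (X⊆Y u∈)
  R-mono X⊆Y (step r e v∈) = step (R-mono X⊆Y r) e (X⊆Y v∈)

  R-trans : ∀ {X u v w} → R X u v → R X v w → R X u w
  R-trans r (here _)      = r
  R-trans r (step q e w∈) = step (R-trans r q) e w∈

  R-sym : ∀ {X u v} → R X u v → R X v u
  R-sym (here u∈)     = here u∈
  R-sym (step r e v∈) = R-trans (step (here v∈) (~-sym e) (R-target r)) (R-sym r)

  -- The walk is followed from its last visit to `u`, so `u` can be deleted; this is what makes
  -- `reach?` terminate.
  R-head : ∀ {X u v} → R X u v → u ≢ v → ∃[ w ] u ~ w × R (X - u) w v
  R-head (here _) u≢v = contradiction refl u≢v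
  R-head {X} {u} (step {v} r e w∈) u≢w with u ≟ v
  ... | yes refl = _ , e , here (x∈p∧x≢y⇒x∈p-y w∈ (u≢w ∘ ≡-sym))
  ... | no  u≢v with R-head r u≢v
  ...   | x , u~x , q = x , u~x , step q e (x∈p∧x≢y⇒x∈p-y w∈ (u≢w ∘ ≡-sym))

  reach? : ∀ X u v → Dec (R X u v)
  reach? X u v = go ∣ X ∣ X ≤-refl u
    where
    go : ∀ m X → ∣ X ∣ ≤ m → ∀ u → Dec (R X u v)
    go m X ≤m u with u ∈? X
    go m X ≤m u | no u∉ = no (u∉ ∘ R-source)
    go zero X ≤m u | yes u∈ = contradiction (≤-trans (x∈p⇒∣p-x∣<∣p∣ u∈) ≤m) (λ ())
    go (suc m) X ≤m u | yes u∈ with u ≟ v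
    ... | yes refl = yes (here u∈)
    ... | no  u≢v  = map′ (λ { (w , e , r) → R-trans (step (here u∈) e (p─q⊆p X _ (R-source r))) (R-mono (p─q⊆p X _) r) })
                          (λ r → R-head r u≢v)
                          (any? (λ w → (u ~? w) ×-dec go m (X - u) (s≤s⁻¹ (≤-trans (x∈p⇒∣p-x∣<∣p∣ u∈) ≤m)) w))

  abstract

    comp : Subset (n G) → V → Subset (n G)
    comp X v = tabulate (λ u → does (reach? X v u))

    ∈comp⁻ : ∀ {X v u} → u ∈ comp X v → R X v u
    ∈comp⁻ {X} {v} {u} u∈ with reach? X v u | trans (≡-sym (lookup∘tabulate (λ u → does (reach? X v u)) u)) ([]=⇒lookup u∈)
    ... | yes r | _  = r

    ∈comp⁺ : ∀ {X v u} → R X v u → u ∈ comp X v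
    ∈comp⁺ {X} {v} {u} r = lookup⇒[]= u _ (trans (lookup∘tabulate _ u) (dec-true (reach? X v u) r))

  Conn : Subset (n G) → Set
  Conn X = ∀ {u v} → u ∈ X → v ∈ X → R X u v

  Closed : Subset (n G) → Subset (n G) → Set
  Closed X K = ∀ {u v} → u ∈ K → u ~ v → v ∈ X → v ∈ K

  comp⊆ : ∀ {X v} → comp X v ⊆ X
  comp⊆ = R-target ∘ ∈comp⁻

  comp-closed : ∀ {X v} → Closed X (comp X v)
  comp-closed u∈ e v∈ = ∈comp⁺ (step (∈comp⁻ u∈) e v∈)

  Closed-reach : ∀ {X K Y u v} → Closed X K → u ∈ K → R (X ─ Y) u v → R (K ─ Y) u v
  Closed-reach cl u∈ (here u∈X)    = here (∈─ u∈ (proj₂ (─⁻ u∈X)))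
  Closed-reach cl u∈ (step r e v∈) =
    step r′ e (∈─ (cl (proj₁ (─⁻ (R-target r′))) e (proj₁ (─⁻ v∈))) (proj₂ (─⁻ v∈)))
    where r′ = Closed-reach cl u∈ r

  comp-reach : ∀ {X v u} → R X v u → R (comp X v) v u
  comp-reach (here v∈)     = here (∈comp⁺ (here v∈))
  comp-reach (step r e u∈) = step (comp-reach r) e (∈comp⁺ (step r e u∈))

  comp-conn : ∀ {X v} → Conn (comp X v)
  comp-conn u∈ w∈ = R-trans (R-sym (comp-reach (∈comp⁻ u∈))) (comp-reach (∈comp⁻ w∈))

  Separates : Subset (n G) → Subset (n G) → Subset (n G) → Set
  Separates K Y Z = ∀ z s → z ∈ Z → s ∈ S → ¬ R (K ─ Y) z s

  separates? : ∀ K Y Z → Dec (Separates K Y Z)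
  separates? K Y Z = all? λ z → all? λ s → (z ∈? Z) →-dec ((s ∈? S) →-dec ¬? (reach? (K ─ Y) z s))

  Separates-mono : ∀ {K K′ Y Y′ Z Z′} → K′ ─ Y′ ⊆ K ─ Y → Z′ ⊆ Z → Separates K Y Z → Separates K′ Y′ Z′
  Separates-mono K⊆ Z⊆ sep z s z∈ s∈ r = sep z s (Z⊆ z∈) s∈ (R-mono K⊆ r)

  Separates-restrict : ∀ {K K′ Y Z Z′} → K′ ⊆ K → Z′ ⊆ Z → Separates K Y Z → Separates K′ (Y ∩ K′) Z′
  Separates-restrict K⊆ = Separates-mono
    (λ v∈ → ∈─ (K⊆ (proj₁ (─⁻ v∈))) (λ v∈Y → proj₂ (─⁻ v∈) (x∈p∩q⁺ (v∈Y , proj₁ (─⁻ v∈)))))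

  ¬Separates : ∀ {K Y Z} → ¬ Separates K Y Z → ∃[ z ] ∃[ s ] z ∈ Z × s ∈ S × R (K ─ Y) z s
  ¬Separates {K} {Y} {Z} ¬sep
    with any? (λ z → any? λ s → (z ∈? Z) ×-dec ((s ∈? S) ×-dec reach? (K ─ Y) z s))
  ... | yes found = found
  ... | no  none  = ⊥-elim (¬sep (λ z s z∈ s∈ r → none (z , s , z∈ , s∈ , r)))

  -- The vertex set is an index because separation depends on it alone; `snoc` fits the search,
  -- which extends a path at its tip.
  data Path (u : V) : V → Subset (n G) → Set where
    single : Path u u ⁅ u ⁆
    snoc   : ∀ {v w Z} → Path u v Z → v ~ w → w ∉ Z → Path u w (Z ∪ ⁅ w ⁆)

  end∈ : ∀ {u v Z} → Path u v Z → v ∈ Z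
  end∈ {u} single               = x∈⁅x⁆ u
  end∈ (snoc {w = w} {Z} _ _ _) = q⊆p∪q Z ⁅ w ⁆ (x∈⁅x⁆ w)

  ∪⁅⁆⁻ : ∀ {Z : Subset (n G)} {z w} → z ∈ Z ∪ ⁅ w ⁆ → z ∈ Z ⊎ z ≡ w
  ∪⁅⁆⁻ {Z} {z} {w} z∈ = [ inj₁ , inj₂ ∘ x∈⁅y⁆⇒x≡y w ]′ (x∈p∪q⁻ Z ⁅ w ⁆ z∈)

  Path-reach : ∀ {u v Z z} → Path u v Z → z ∈ Z → R Z u z
  Path-reach {u} single z∈ rewrite x∈⁅y⁆⇒x≡y u z∈ = here (x∈⁅x⁆ u)
  Path-reach (snoc {w = w} {Z} p e w∉) z∈ with ∪⁅⁆⁻ z∈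
  ... | inj₁ z∈Z  = R-mono (p⊆p∪q ⁅ w ⁆) (Path-reach p z∈Z)
  ... | inj₂ refl = step (R-mono (p⊆p∪q ⁅ w ⁆) (Path-reach p (end∈ p))) e z∈

  start∈ : ∀ {u v Z} → Path u v Z → u ∈ Z
  start∈ p = R-source (Path-reach p (end∈ p))

  Path-conn : ∀ {u v Z} → Path u v Z → Conn Z
  Path-conn p x∈ y∈ = R-trans (R-sym (Path-reach p x∈)) (Path-reach p y∈)

  prefix : ∀ {u v w Z} → Path u v Z → w ∈ Z → ∃[ Z′ ] Path u w Z′ × Z′ ⊆ Z
  prefix {u} single w∈ rewrite x∈⁅y⁆⇒x≡y u w∈ = ⁅ u ⁆ , single , id
  prefix (snoc {w = w} p e w∉) z∈ with ∪⁅⁆⁻ z∈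
  ... | inj₂ refl = _ , snoc p e w∉ , id
  ... | inj₁ z∈Z with prefix p z∈Z
  ...   | Z′ , q , Z′⊆ = Z′ , q , p⊆p∪q ⁅ w ⁆ ∘ Z′⊆

  -- Both parts contain `w`; uncrossing needs such a common vertex.
  record Split (u v w : V) (Z : Subset (n G)) : Set where
    field
      {before after} : Subset (n G)
      to      : Path u w before
      from    : Path w v after
      before⊆ : before ⊆ Z
      after⊆  : after ⊆ Z
      covers  : Z ⊆ before ∪ after

  splitAt : ∀ {u v w Z} → Path u v Z → w ∈ Z → Split u v w Z
  splitAt {u} single w∈ rewrite x∈⁅y⁆⇒x≡y u w∈ = record
    { to = single ; from = single ; before⊆ = id ; after⊆ = id ; covers = p⊆p∪q ⁅ u ⁆ }
  splitAt (snoc {w = w} {Z} p e w∉) z∈ with ∪⁅⁆⁻ z∈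
  ... | inj₂ refl = record
    { to = snoc p e w∉ ; from = single ; before⊆ = id ; after⊆ = q⊆p∪q Z ⁅ w ⁆ ; covers = p⊆p∪q ⁅ w ⁆ }
  ... | inj₁ z∈Z = record
    { to = to ; from = snoc from e (w∉ ∘ after⊆) ; before⊆ = p⊆p∪q ⁅ w ⁆ ∘ before⊆
    ; after⊆ = λ x∈ → [ p⊆p∪q ⁅ w ⁆ ∘ after⊆ , (λ { refl → q⊆p∪q Z ⁅ w ⁆ (x∈⁅x⁆ w) }) ]′ (∪⁅⁆⁻ x∈)
    ; covers = λ x∈ → subst (_ ∈_) (∪-assoc before after ⁅ w ⁆)
        ([ p⊆p∪q ⁅ w ⁆ ∘ covers , (λ { refl → q⊆p∪q (before ∪ after) ⁅ w ⁆ (x∈⁅x⁆ w) }) ]′ (∪⁅⁆⁻ x∈)) }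
    where open Split (splitAt p z∈Z)

  glue : ∀ {u v w Z Z′} → Path u w Z → Path w v Z′ → (∀ {z} → z ∈ Z → z ∈ Z′ → z ≡ w) → Path u v (Z ∪ Z′)
  glue {u} {w = w} {Z} p single only = subst (Path u w) (≡-sym Z∪⁅w⁆≡Z) p
    where
    Z∪⁅w⁆≡Z : Z ∪ ⁅ w ⁆ ≡ Z
    Z∪⁅w⁆≡Z = ⊆-antisym (λ z∈ → [ id , (λ { refl → end∈ p }) ]′ (∪⁅⁆⁻ z∈)) (p⊆p∪q ⁅ w ⁆)
  glue {u} {Z = Z} p (snoc {w = v} {Z′} q e v∉) only =
    subst (Path u v) (∪-assoc Z Z′ ⁅ v ⁆)
      (snoc (glue p q (λ z∈ z∈′ → only z∈ (p⊆p∪q ⁅ v ⁆ z∈′))) e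
        (λ v∈ → [ (λ v∈Z → v∉ (subst (_∈ Z′) (≡-sym (only v∈Z (q⊆p∪q Z′ ⁅ v ⁆ (x∈⁅x⁆ v)))) (start∈ q))) , v∉ ]′ (x∈p∪q⁻ Z Z′ v∈)))

  cons : ∀ {u v w Z} → w ~ u → Path u v Z → w ∉ Z → Path w v (⁅ w ⁆ ∪ Z)
  cons {u} {w = w} e single w∉ =
    snoc single e (λ u∈ → w∉ (subst (_∈ ⁅ u ⁆) (x∈⁅y⁆⇒x≡y w u∈) (x∈⁅x⁆ u)))
  cons {w = w} e (snoc {w = v} {Z} p f v∉) w∉ =
    subst (Path w v) (∪-assoc ⁅ w ⁆ Z ⁅ v ⁆)
      (snoc (cons e p (w∉ ∘ p⊆p∪q ⁅ v ⁆)) f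
        (λ v∈ → [ (λ v∈w → w∉ (subst (_∈ Z ∪ ⁅ v ⁆) (x∈⁅y⁆⇒x≡y w v∈w) (q⊆p∪q Z ⁅ v ⁆ (x∈⁅x⁆ v)))) , v∉ ]′ (x∈p∪q⁻ ⁅ w ⁆ Z v∈)))

  reverse : ∀ {u v Z} → Path u v Z → Path v u Z
  reverse single = single
  reverse {u} (snoc {w = w} {Z} p e w∉) = subst (Path w u) (∪-comm ⁅ w ⁆ Z) (cons (~-sym e) (reverse p) w∉)

  p∪⁅x⁆-x≡p : ∀ {p : Subset (n G)} {x} → x ∉ p → (p ∪ ⁅ x ⁆) - x ≡ p
  p∪⁅x⁆-x≡p {p} {x} x∉p = ⊆-antisym
    (λ z∈ → [ id , (λ { refl → contradiction z∈ (x∉p-x (p ∪ ⁅ x ⁆)) }) ]′ (∪⁅⁆⁻ (p─q⊆p (p ∪ ⁅ x ⁆) ⁅ x ⁆ z∈)))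
    (λ z∈ → x∈p∧x≢y⇒x∈p-y (p⊆p∪q ⁅ x ⁆ z∈) (λ { refl → x∉p z∈ }))

  path? : ∀ u v Z → Dec (Path u v Z)
  path? u v Z = go ∣ Z ∣ v Z ≤-refl
    where
    Last : V → Subset (n G) → Set
    Last v Z = (u ≡ v × Z ≡ ⁅ v ⁆) ⊎ (∃[ w ] Path u w (Z - v) × w ~ v)
    fromLast : ∀ {v Z} → v ∈ Z → Last v Z → Path u v Z
    fromLast v∈ (inj₁ (refl , refl)) = single
    fromLast {v} {Z} v∈ (inj₂ (w , p , e)) = subst (Path u v) (p-x∪⁅x⁆≡p v∈) (snoc p e (x∉p-x Z))
    toLast : ∀ {v Z} → Path u v Z → Last v Z
    toLast single = inj₁ (refl , refl)
    toLast (snoc {v} p e w∉) = inj₂ (v , subst (Path u v) (≡-sym (p∪⁅x⁆-x≡p w∉)) p , e)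
    go : ∀ m v Z → ∣ Z ∣ ≤ m → Dec (Path u v Z)
    go m v Z ≤m with v ∈? Z
    go m v Z ≤m | no v∉ = no (v∉ ∘ end∈)
    go zero v Z ≤m | yes v∈ = contradiction (≤-trans (x∈p⇒∣p-x∣<∣p∣ v∈) ≤m) (λ ())
    go (suc m) v Z ≤m | yes v∈ = map′ (fromLast v∈) toLast
      (((u ≟ v) ×-dec ≡-dec Bool._≟_ Z ⁅ v ⁆)
       ⊎-dec any? (λ w → go m w (Z - v) (s≤s⁻¹ (≤-trans (x∈p⇒∣p-x∣<∣p∣ v∈) ≤m)) ×-dec (w ~? v)))

  record Connection (W A B : Subset (n G)) : Set where
    field
      {a b}  : V
      {Z}    : Subset (n G)
      path   : Path a b Z
      a∈A    : a ∈ A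
      b∈B    : b ∈ B
      within : Z ⊆ W
      onlyA  : ∀ {z} → z ∈ Z → z ∈ A → z ≡ a
      onlyB  : ∀ {z} → z ∈ Z → z ∈ B → z ≡ b

  -- One pass over the walk suffices: the path restarts at each vertex of `A`, is cut back to a
  -- prefix at a repeated vertex, and is complete at the first vertex of `B`.
  connect : ∀ {W A B u v} → (∀ {x} → x ∈ A → x ∉ B) → u ∈ A → v ∈ B → R W u v → Connection W A B
  connect {W} {A} {B} {u} A∩B=∅ u∈A v∈B r = [ id , (λ p → contradiction v∈B (avoids p)) ]′ (go r)
    where
    record Partial (v : V) : Set where
      field
        {a}    : V
        {Z}    : Subset (n G)
        path   : Path a v Z
        a∈A    : a ∈ A
        within : Z ⊆ W
        onlyA  : ∀ {z} → z ∈ Z → z ∈ A → z ≡ a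
        offB   : ∀ {z} → z ∈ Z → z ∉ B
    avoids : ∀ {v} → Partial v → v ∉ B
    avoids p = Partial.offB p (end∈ (Partial.path p))
    fresh : ∀ {v} → v ∈ W → v ∈ A → Partial v
    fresh {v} v∈W v∈A = record
      { path = single ; a∈A = v∈A
      ; within = λ z∈ → subst (_∈ W) (≡-sym (x∈⁅y⁆⇒x≡y v z∈)) v∈W
      ; onlyA = λ z∈ _ → x∈⁅y⁆⇒x≡y v z∈
      ; offB = λ z∈ → subst (_∉ B) (≡-sym (x∈⁅y⁆⇒x≡y v z∈)) (A∩B=∅ v∈A) }
    extend : ∀ {v w} → Partial v → v ~ w → w ∈ W → Connection W A B ⊎ Partial w
    extend {w = w} p e w∈W with w ∈? A | w ∈? Partial.Z p
    ... | yes w∈A | _ = inj₂ (fresh w∈W w∈A)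
    ... | no  _   | yes w∈Z with prefix (Partial.path p) w∈Z
    ...   | Z′ , q , Z′⊆ = inj₂ (record
            { path = q ; a∈A = P.a∈A ; within = P.within ∘ Z′⊆
            ; onlyA = P.onlyA ∘ Z′⊆ ; offB = P.offB ∘ Z′⊆ })
      where module P = Partial p
    extend {w = w} p e w∈W | no w∉A | no w∉Z with w ∈? B
    ... | yes w∈B = inj₁ (record
            { path = snoc P.path e w∉Z ; a∈A = P.a∈A ; b∈B = w∈B
            ; within = λ z∈ → [ P.within , (λ { refl → w∈W }) ]′ (∪⁅⁆⁻ z∈)
            ; onlyA = λ z∈ z∈A → [ (λ z∈Z → P.onlyA z∈Z z∈A) , (λ { refl → contradiction z∈A w∉A }) ]′ (∪⁅⁆⁻ z∈)
            ; onlyB = λ z∈ z∈B → [ (λ z∈Z → contradiction z∈B (P.offB z∈Z)) , id ]′ (∪⁅⁆⁻ z∈) })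
      where module P = Partial p
    ... | no w∉B = inj₂ (record
            { path = snoc P.path e w∉Z ; a∈A = P.a∈A
            ; within = λ z∈ → [ P.within , (λ { refl → w∈W }) ]′ (∪⁅⁆⁻ z∈)
            ; onlyA = λ z∈ z∈A → [ (λ z∈Z → P.onlyA z∈Z z∈A) , (λ { refl → contradiction z∈A w∉A }) ]′ (∪⁅⁆⁻ z∈)
            ; offB = λ z∈ → [ P.offB , (λ { refl → w∉B }) ]′ (∪⁅⁆⁻ z∈) })
      where module P = Partial p
    go : ∀ {v} → R W u v → Connection W A B ⊎ Partial v
    go (here u∈W) = inj₂ (fresh u∈W u∈A)
    go (step r e w∈) with go r
    ... | inj₁ c = inj₁ c
    ... | inj₂ p = extend p e w∈

  -- Uncrossing two separators

  -- `Y′` is left open because in `uncross` the set `Y` is a union of two separators, and the one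
  -- that contains `d` becomes known only afterwards.
  firstHit : ∀ {K Y u v} → R K u v →
             R (K ─ Y) u v ⊎ (∃[ d ] d ∈ Y × (∀ {Y′} → Y′ ⊆ Y → d ∉ Y′ → R (K ─ Y′) u d))
  firstHit {K} {Y} {u} (here u∈) with u ∈? Y
  ... | yes u∈Y = inj₂ (u , u∈Y , λ _ u∉ → here (∈─ u∈ u∉))
  ... | no  u∉Y = inj₁ (here (∈─ u∈ u∉Y))
  firstHit {K} {Y} (step {w = w} r e w∈) with firstHit {Y = Y} r
  ... | inj₂ hit = inj₂ hit
  ... | inj₁ q with w ∈? Y
  ...   | yes w∈Y = inj₂ (w , w∈Y , λ Y′⊆ w∉ → step (R-mono (─-mono id Y′⊆) q) e (∈─ w∈ w∉))
  ...   | no  w∉Y = inj₁ (step q e (∈─ w∈ w∉Y))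

  through : ∀ {K Y₁ Y₂ z v} d → R (K ─ ((Y₁ - d) ∪ Y₂)) z v →
            R (K ─ Y₁) z v ⊎ R (K ─ ((Y₁ - d) ∪ Y₂)) d v
  through {K} {Y₁} {Y₂} d = go
    where
    keep : ∀ {v} → v ∈ K ─ ((Y₁ - d) ∪ Y₂) → v ≢ d → v ∈ K ─ Y₁
    keep v∈ v≢d = ∈─ (proj₁ (─⁻ v∈)) (λ v∈₁ → proj₂ (─⁻ v∈) (p⊆p∪q Y₂ (x∈p∧x≢y⇒x∈p-y v∈₁ v≢d)))
    go : ∀ {z v} → R (K ─ ((Y₁ - d) ∪ Y₂)) z v → R (K ─ Y₁) z v ⊎ R (K ─ ((Y₁ - d) ∪ Y₂)) d v
    go {z} (here z∈) with z ≟ d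
    ... | yes refl = inj₂ (here z∈)
    ... | no  z≢d  = inj₁ (here (keep z∈ z≢d))
    go (step {w = v} q e v∈) with v ≟ d | go q
    ... | yes refl | _       = inj₂ (here v∈)
    ... | no _     | inj₂ q′ = inj₂ (step q′ e v∈)
    ... | no v≢d   | inj₁ q′ = inj₁ (step q′ e (keep v∈ v≢d))

  -- Only a walk from `Z₁` through `d` could escape. But then `r`, which reaches `d` around `Y₂`,
  -- would reach `S` around `Y₂` as well.
  exchange : ∀ {K Y₁ Y₂ Z₁ Z₂ r d} → Separates K Y₁ Z₁ → Separates K Y₂ Z₂ → r ∈ Z₂ →
             d ∈ Y₁ → (d ∉ Y₂ → R (K ─ Y₂) r d) → Separates K ((Y₁ - d) ∪ Y₂) (Z₁ ∪ Z₂)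
  exchange {K} {Y₁} {Y₂} {Z₁} {Z₂} {r} {d} sep₁ sep₂ r∈₂ d∈₁ rd z t z∈ t∈ q
    with x∈p∪q⁻ Z₁ Z₂ z∈ | through d q
  ... | inj₂ z∈₂ | _       = sep₂ z t z∈₂ t∈ (R-mono (─-mono id (q⊆p∪q (Y₁ - d) Y₂)) q)
  ... | inj₁ z∈₁ | inj₁ q₁ = sep₁ z t z∈₁ t∈ q₁
  ... | inj₁ _   | inj₂ q₂ = sep₂ r t r∈₂ t∈ (R-trans (rd (proj₂ (─⁻ (R-source q₃)))) q₃)
    where q₃ = R-mono (─-mono id (q⊆p∪q (Y₁ - d) Y₂)) q₂

  ∣p-x∪q∣<∣p∣+∣q∣ : ∀ {p : Subset (n G)} q {x} → x ∈ p → ∣ (p - x) ∪ q ∣ < ∣ p ∣ + ∣ q ∣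
  ∣p-x∪q∣<∣p∣+∣q∣ {p} q {x} x∈p =
    ≤-trans (s≤s (∣p∪q∣≤∣p∣+∣q∣ (p - x) q)) (+-monoˡ-≤ ∣ q ∣ (x∈p⇒∣p-x∣<∣p∣ x∈p))

  -- Submodularity of separation: a walk from r to S must hit Y₁ ∪ Y₂; its first hit d
  -- can be discarded from one of the two separators.
  uncross : ∀ {K Y₁ Y₂ Z₁ Z₂ r s} → Separates K Y₁ Z₁ → Separates K Y₂ Z₂ →
            r ∈ Z₁ → r ∈ Z₂ → s ∈ S → R K r s →
            ∃[ D ] ∣ D ∣ < ∣ Y₁ ∣ + ∣ Y₂ ∣ × Separates K D (Z₁ ∪ Z₂)
  uncross {K} {Y₁} {Y₂} {Z₁} {Z₂} {r} {s} sep₁ sep₂ r∈₁ r∈₂ s∈ rs with firstHit {Y = Y₁ ∪ Y₂} rs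
  ... | inj₁ q = contradiction (R-mono (─-mono id (p⊆p∪q Y₂)) q) (sep₁ r s r∈₁ s∈)
  ... | inj₂ (d , d∈ , hit) with x∈p∪q⁻ Y₁ Y₂ d∈
  ...   | inj₁ d∈₁ = (Y₁ - d) ∪ Y₂ , ∣p-x∪q∣<∣p∣+∣q∣ Y₂ d∈₁
                   , exchange sep₁ sep₂ r∈₂ d∈₁ (hit (q⊆p∪q Y₁ Y₂))
  ...   | inj₂ d∈₂ = (Y₂ - d) ∪ Y₁
                   , subst (∣ (Y₂ - d) ∪ Y₁ ∣ <_) (+-comm ∣ Y₂ ∣ ∣ Y₁ ∣) (∣p-x∪q∣<∣p∣+∣q∣ Y₁ d∈₂)
                   , subst (Separates K _) (∪-comm Z₂ Z₁) (exchange sep₂ sep₁ r∈₁ d∈₂ (hit (p⊆p∪q Y₂)))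

  -- Flat and big vertex sets

  -- By Menger's theorem, Flat k W says that G[W] has no S-rooted model of P_(k+1), and Big k K
  -- below says that G[K] has one of P_k.
  Flat : ℕ → Subset (n G) → Set
  Flat k W = ∀ {u v Z} → Path u v Z → Z ⊆ W → ∃[ Y ] ∣ Y ∣ ≤ k × Separates W Y Z

  Flat-mono : ∀ {k W W′} → W′ ⊆ W → Flat k W → Flat k W′
  Flat-mono W′⊆W flat p Z⊆ with flat p (W′⊆W ∘ Z⊆)
  ... | Y , ∣Y∣≤k , sep = Y , ∣Y∣≤k , Separates-mono (─-mono W′⊆W id) id sep

  SmallSeparator : ℕ → Subset (n G) → Subset (n G) → Set
  SmallSeparator k K Z = ∃[ Y ] ∣ Y ∣ < k × Separates K Y Z

  smallSeparator? : ∀ k K Z → Dec (SmallSeparator k K Z)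
  smallSeparator? k K Z = anySubset? (λ Y → (∣ Y ∣ <? k) ×-dec separates? K Y Z)

  record Big (k : ℕ) (K : Subset (n G)) : Set where
    constructor big
    field
      {u v} : V
      {Z}   : Subset (n G)
      path  : Path u v Z
      Z⊆K   : Z ⊆ K
      thick : ¬ SmallSeparator k K Z

  -- The search has to decide whether anything big is left; paths and separators range over finitely
  -- many subsets.
  big? : ∀ k K → Dec (Big k K)
  big? k K = map′ from to (anySubset? thick?)
    where
    Thick : Subset (n G) → Set
    Thick Z = Z ⊆ K × (∃[ u ] ∃[ v ] Path u v Z) × ¬ SmallSeparator k K Z
    from : ∃ Thick → Big k K
    from (Z , Z⊆ , (u , v , p) , t) = big p Z⊆ t
    to : Big k K → ∃ Thick
    to (big {u} {v} {Z} p Z⊆ t) = Z , (λ {x} → Z⊆ {x}) , (u , v , p) , t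
    thick? : ∀ Z → Dec (Thick Z)
    thick? Z = (Z ⊆? K) ×-dec ((any? λ u → any? λ v → path? u v Z) ×-dec ¬? (smallSeparator? k K Z))

  ¬Big⇒Flat : ∀ {k W} → ¬ Big (suc k) W → Flat k W
  ¬Big⇒Flat {k} {W} ¬big {Z = Z} p Z⊆ with smallSeparator? (suc k) W Z
  ... | yes (Y , ∣Y∣≤k , sep) = Y , s≤s⁻¹ ∣Y∣≤k , sep
  ... | no thick              = ⊥-elim (¬big (big p Z⊆ thick))

  Big-mono : ∀ {k K K′} → K ⊆ K′ → Big k K → Big k K′
  Big-mono K⊆K′ (big p Z⊆ thick) =
    big p (K⊆K′ ∘ Z⊆) (λ { (Y , ∣Y∣<k , sep) → thick (Y , ∣Y∣<k , Separates-mono (─-mono K⊆K′ id) id sep) })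

  -- The empty set has fewer than `suc k` elements and therefore does not separate.
  Big-meets-S : ∀ {k K} (B : Big (suc k) K) → ∃[ z ] ∃[ s ] z ∈ Big.Z B × s ∈ S × R K z s
  Big-meets-S {k} {K} (big {Z = Z} p Z⊆ thick)
    with ¬Separates (λ sep → thick (⊥ , subst (_< suc k) (≡-sym (∣⊥∣≡0 (n G))) (s≤s z≤n) , sep))
  ... | z , s , z∈ , s∈ , r = z , s , z∈ , s∈ , R-mono (p─q⊆p K ⊥) r

  -- Walks that start on the path stay in its component, so a separator there would also be one in
  -- `X`.
  Big-comp : ∀ {k X} (B : Big k X) → Big k (comp X (Big.u B))
  Big-comp {k} {X} (big {u} {v} {Z} p Z⊆ thick) = big p Z⊆comp
    (λ { (Y , ∣Y∣<k , sep) → thick (Y , ∣Y∣<k , λ z s z∈ s∈ r → sep z s z∈ s∈ (Closed-reach comp-closed (Z⊆comp z∈) r)) })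
    where
    Z⊆comp : Z ⊆ comp X u
    Z⊆comp z∈ = ∈comp⁺ (R-mono Z⊆ (Path-reach p z∈))

  double-count : ∀ {k} a b c d → suc k ≤ a + b → suc k ≤ d + c → a + c ≤ k → ¬ (b + d ≤ k)
  double-count {k} a b c d ab dc ac bd = <-irrefl refl (begin-strict
    k + k              <⟨ +-mono-<-≤ ab (<⇒≤ dc) ⟩
    (a + b) + (d + c)  ≡⟨ cong (a + b +_) (+-comm d c) ⟩
    (a + b) + (c + d)  ≡⟨ interchange +-commutativeSemigroup a b c d ⟩
    (a + c) + (b + d)  ≤⟨ +-mono-≤ ac bd ⟩
    k + k              ∎)
    where open ≤-Reasoning

  -- Cut both big paths where a connecting path attaches and recombine: flatness separates the
  -- two new paths by at most 2 (k + 1) vertices in total, whereas uncrossing inside K₁ and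
  -- inside K₂ shows that at least 2 (k + 2) are needed.
  noTwoBig : ∀ {k W K₁ K₂} → Flat (suc k) W → Conn W → K₁ ⊆ W → K₂ ⊆ W → (∀ {x} → x ∈ K₁ → x ∉ K₂) →
             Big (suc k) K₁ → ¬ Big (suc k) K₂
  noTwoBig {k} {W} {K₁} {K₂} flat conn K₁⊆ K₂⊆ dis B₁ B₂ =
    double-count (∣ Y ∩ K₁ ∣) (∣ Y′ ∩ K₁ ∣) (∣ Y ∩ K₂ ∣) (∣ Y′ ∩ K₂ ∣) many₁ many₂
      (≤-trans (∣p∩q∣+∣p∩r∣≤∣p∣ Y K₁ K₂ dis) Y≤) (≤-trans (∣p∩q∣+∣p∩r∣≤∣p∣ Y′ K₁ K₂ dis) Y′≤)
    where
    module B₁ = Big B₁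
    module B₂ = Big B₂
    link : Connection W B₁.Z B₂.Z
    link = connect (λ x∈₁ x∈₂ → dis (B₁.Z⊆K x∈₁) (B₂.Z⊆K x∈₂)) (start∈ B₁.path) (start∈ B₂.path)
             (conn (K₁⊆ (B₁.Z⊆K (start∈ B₁.path))) (K₂⊆ (B₂.Z⊆K (start∈ B₂.path))))
    module L = Connection link
    module P₁ = Split (splitAt B₁.path L.a∈A)
    module P₂ = Split (splitAt B₂.path L.b∈B)

    recombine : ∀ {x y A B} → Path x L.a A → Path L.b y B → A ⊆ B₁.Z → B ⊆ B₂.Z →
                ∃[ Y ] ∣ Y ∣ ≤ suc k × Separates W Y ((A ∪ L.Z) ∪ B)
    recombine {A = A} {B} p q A⊆ B⊆ = flat
      (glue (glue p L.path (λ z∈A z∈Z → L.onlyA z∈Z (A⊆ z∈A))) q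
        (λ z∈ z∈B → [ (λ z∈A → contradiction (B₂.Z⊆K (B⊆ z∈B)) (dis (B₁.Z⊆K (A⊆ z∈A))))
                    , (λ z∈Z → L.onlyB z∈Z (B⊆ z∈B)) ]′ (x∈p∪q⁻ A L.Z z∈)))
      (λ z∈ → [ (λ z∈AZ → [ K₁⊆ ∘ B₁.Z⊆K ∘ A⊆ , L.within ]′ (x∈p∪q⁻ A L.Z z∈AZ))
              , K₂⊆ ∘ B₂.Z⊆K ∘ B⊆ ]′ (x∈p∪q⁻ (A ∪ L.Z) B z∈))

    -- `first` and `second` together use each half of each big path exactly once.
    first  = recombine P₁.to P₂.from P₁.before⊆ P₂.after⊆
    second = recombine (reverse P₁.from) (reverse P₂.to) P₁.after⊆ P₂.before⊆
    Y Y′ : Subset (n G)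
    Y  = proj₁ first
    Y′ = proj₁ second
    Y≤ : ∣ Y ∣ ≤ suc k
    Y≤ = proj₁ (proj₂ first)
    Y′≤ : ∣ Y′ ∣ ≤ suc k
    Y′≤ = proj₁ (proj₂ second)

    -- The uncrossed set `D` separates a big path and so has at least `suc k` elements; `uncross`
    -- makes it strictly smaller than the sum, which accounts for the second `suc`.
    many : ∀ {K A A′ Y Y′ r} (B : Big (suc k) K) → Big.Z B ⊆ A ∪ A′ → r ∈ Big.Z B → r ∈ A → r ∈ A′ →
           Separates K Y A → Separates K Y′ A′ → suc (suc k) ≤ ∣ Y ∣ + ∣ Y′ ∣
    many B covers r∈ r∈A r∈A′ sep sep′ with Big-meets-S B
    ... | z , s , z∈ , s∈ , zs with uncross sep sep′ r∈A r∈A′ s∈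
                                    (R-trans (R-mono (Big.Z⊆K B) (Path-conn (Big.path B) r∈ z∈)) zs)
    ...   | D , D< , sepD = ≤-trans
            (s≤s (≮⇒≥ (λ ∣D∣<k → Big.thick B (D , ∣D∣<k , Separates-mono id covers sepD)))) D<

    many₁ : suc (suc k) ≤ ∣ Y ∩ K₁ ∣ + ∣ Y′ ∩ K₁ ∣
    many₁ = many B₁ P₁.covers L.a∈A (end∈ P₁.to) (start∈ P₁.from)
      (Separates-restrict K₁⊆ (p⊆p∪q P₂.after ∘ p⊆p∪q L.Z) (proj₂ (proj₂ first)))
      (Separates-restrict K₁⊆ (p⊆p∪q P₂.before ∘ p⊆p∪q L.Z) (proj₂ (proj₂ second)))

    many₂ : suc (suc k) ≤ ∣ Y′ ∩ K₂ ∣ + ∣ Y ∩ K₂ ∣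
    many₂ = many B₂ (λ z∈ → P₂.covers z∈) L.b∈B (end∈ P₂.to) (start∈ P₂.from)
      (Separates-restrict K₂⊆ (q⊆p∪q (P₁.after ∪ L.Z) P₂.before) (proj₂ (proj₂ second)))
      (Separates-restrict K₂⊆ (q⊆p∪q (P₁.before ∪ L.Z) P₂.after) (proj₂ (proj₂ first)))

  -- A path that meets every big connected set

  enter : ∀ {X D c d} → R X c d → c ∉ D → d ∈ D → ∃[ x ] ∃[ y ] x ∈ X × x ∉ D × x ~ y × y ∈ D
  enter (here _) c∉D d∈D = contradiction d∈D c∉D
  enter {D = D} (step {v = v} r e _) c∉D d∈D with v ∈? D
  ... | yes v∈D = enter r c∉D v∈D
  ... | no  v∉D = _ , _ , R-target r , v∉D , e , d∈D

  -- Such sets `D` are unions of components of `W ─ Z`, indeed single ones as they are connected: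
  -- the tip `v` can step into each big component.
  Invariant : ℕ → Subset (n G) → Subset (n G) → V → Set
  Invariant k W Z v = ∀ {D} → D ⊆ W ─ Z → Closed (W ─ Z) D → Conn D → Big k D → ∃[ d ] d ∈ D × v ~ d

  -- By `noTwoBig` the new big component `D` meets the old one `K`, so a walk inside `K` leads from
  -- `c` into `D`. The vertex from which it enters must be `c`, since any other would already belong
  -- to `D`.
  advance : ∀ {k W Z K c} → Flat (suc k) W → Conn W → K ⊆ W ─ Z → Conn K → Big (suc k) K → c ∈ K →
            Invariant (suc k) W (Z ∪ ⁅ c ⁆) c
  advance {k} {W} {Z} {K} {c} flat conn K⊆ connK bigK c∈ {D} D⊆ closed connD bigD
    with nonempty? (K ∩ D)
  ... | no disjoint = ⊥-elim (noTwoBig flat conn (proj₁ ∘ ─⁻ ∘ K⊆) (proj₁ ∘ ─⁻ ∘ D⊆)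
                               (λ x∈K x∈D → disjoint (_ , x∈p∩q⁺ (x∈K , x∈D))) bigK bigD)
  ... | yes (d , d∈) with x∈p∩q⁻ K D d∈
  ...   | d∈K , d∈D with enter (connK c∈ d∈K) (λ c∈D → proj₂ (─⁻ (D⊆ c∈D)) (q⊆p∪q Z ⁅ c ⁆ (x∈⁅x⁆ c))) d∈D
  ...     | x , y , x∈K , x∉D , e , y∈D with x ≟ c
  ...       | yes refl = y , y∈D , e
  ...       | no  x≢c  = contradiction
              (closed y∈D (~-sym e) (∈─ (proj₁ (─⁻ (K⊆ x∈K))) (λ x∈ → [ proj₂ (─⁻ (K⊆ x∈K)) , x≢c ]′ (∪⁅⁆⁻ x∈)))) x∉D

  -- Depth-first search: the path is always extended into the unique component that is still big.
  search : ∀ {k W u v Z} → Flat (suc k) W → Conn W → Path u v Z → Z ⊆ W → Invariant (suc k) W Z v →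
           ∀ m → ∣ W ─ Z ∣ ≤ m → ∃[ w ] ∃[ Z′ ] Path u w Z′ × Z′ ⊆ W × ¬ Big (suc k) (W ─ Z′)
  search {k} {W} {u} {v} {Z} flat conn p Z⊆ inv m ≤m with big? (suc k) (W ─ Z)
  ... | no ¬big = v , Z , p , Z⊆ , ¬big
  ... | yes B with inv comp⊆ comp-closed comp-conn (Big-comp B) | m
  ...   | c , c∈ , _ | zero  = contradiction (≤-trans (nonempty⇒∣p∣>0 (comp⊆ c∈)) ≤m) (λ ())
    where
    nonempty⇒∣p∣>0 : ∀ {p : Subset (n G)} {x} → x ∈ p → 0 < ∣ p ∣
    nonempty⇒∣p∣>0 x∈ = ≤-trans (s≤s z≤n) (x∈p⇒∣p-x∣<∣p∣ x∈)
  ...   | c , c∈ , e | suc m = search flat conn (snoc p e (proj₂ c∈W─Z))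
          (λ z∈ → [ Z⊆ , (λ { refl → proj₁ c∈W─Z }) ]′ (∪⁅⁆⁻ z∈))
          (advance flat conn comp⊆ comp-conn (Big-comp B) c∈)
          m (s≤s⁻¹ (≤-trans (p⊂q⇒∣p∣<∣q∣
            (─-mono id (p⊆p∪q ⁅ c ⁆) , c , comp⊆ c∈ , λ c∈′ → proj₂ (─⁻ c∈′) (q⊆p∪q Z ⁅ c ⁆ (x∈⁅x⁆ c)))) ≤m))
    where
    c∈W─Z : c ∈ W × c ∉ Z
    c∈W─Z = ─⁻ (comp⊆ c∈)

  flat-separator : ∀ {k W w} → Flat (suc k) W → Conn W → w ∈ W → ∃[ Y ] ∣ Y ∣ ≤ suc k × Flat k (W ─ Y)
  flat-separator {k} {W} {w} flat conn w∈ with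
    search flat conn single (λ z∈ → subst (_∈ W) (≡-sym (x∈⁅y⁆⇒x≡y w z∈)) w∈) initial ∣ W ─ ⁅ w ⁆ ∣ ≤-refl
    where
    initial : Invariant (suc k) W ⁅ w ⁆ w
    initial {D} D⊆ closed connD bigD
      with start∈ (Big.path bigD)
    ... | s∈ with enter (conn w∈ (proj₁ (─⁻ (D⊆ (Big.Z⊆K bigD s∈))))) (λ w∈D → proj₂ (─⁻ (D⊆ w∈D)) (x∈⁅x⁆ w)) (Big.Z⊆K bigD s∈)
    ...   | x , y , x∈W , x∉D , e , y∈D with x ≟ w
    ...     | yes refl = y , y∈D , e
    ...     | no  x≢w  = contradiction (closed y∈D (~-sym e) (x∈p∧x≢y⇒x∈p-y x∈W x≢w)) x∉D
  ... | v , Z , p , Z⊆ , ¬big with flat p Z⊆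
  ...   | Y , ∣Y∣≤ , sep = Y , ∣Y∣≤ , ¬Big⇒Flat ¬bigY
    where
    -- A big component either meets `Z` and then links `Z` to `S` around `Y`, or it lies in `W ─ Z`.
    ¬bigY : ¬ Big (suc k) (W ─ Y)
    ¬bigY B with nonempty? (Z ∩ comp (W ─ Y) (Big.u B)) | Big-meets-S (Big-comp B)
    ... | yes (z , z∈) | q , s , q∈ , s∈ , qs with x∈p∩q⁻ Z _ z∈
    ...   | z∈Z , z∈K = sep z s z∈Z s∈ (R-mono comp⊆ (R-trans (comp-conn z∈K (R-source qs)) qs))
    ¬bigY B | no disjoint | _ = ¬big (Big-mono
      (λ x∈ → ∈─ (proj₁ (─⁻ (comp⊆ x∈))) (λ x∈Z → disjoint (_ , x∈p∩q⁺ (x∈Z , x∈)))) (Big-comp B))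

  -- Elimination forests

  Parent : Set
  Parent = V → Maybe V

  -- Neighbours count only within `W`, so that forests can be built piece by piece; a deleted vertex
  -- is dealt with when it returns as a root.
  OnChain : Subset (n G) → Subset (n G) → Parent → Subset (n G) → Set
  OnChain W H parent K = let open Forest G H parent in
      (∀ {v} → v ∈ W → ¬ NbrOf K v)
    ⊎ (∃[ x ] x ∈ H × (∀ {v} → v ∈ W → NbrOf K v → v ≡ x ⊎ Anc v x))

  -- An elimination forest of (G[W], S ∩ W) of vertex-height at most h; the vertex x in OnChain
  -- need not be a leaf.
  record ElimForest (W : Subset (n G)) (h : ℕ) : Set where
    field
      H      : Subset (n G)
      parent : Parent
    open Forest G H parent public using (Depth; Anc; ElimOfInduced)
    field
      H⊆W    : H ⊆ W
      S∩W⊆H  : ∀ {v} → v ∈ S → v ∈ W → v ∈ H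
      closed : ∀ {v w} → v ∈ H → parent v ≡ just w → w ∈ H
      depth  : ∀ {v} → v ∈ H → ∃[ d ] Depth v d × d ≤ h
      elim   : ElimOfInduced
      chain  : ∀ K → K ⊆ W ─ H → Connected G K → Closed (W ─ H) K → OnChain W H parent K

  raise : ∀ {W h h′} → h ≤ h′ → ElimForest W h → ElimForest W h′
  raise h≤h′ E = record
    { H = H ; parent = parent ; H⊆W = H⊆W ; S∩W⊆H = S∩W⊆H ; closed = closed
    ; depth = λ v∈ → let (d , D , d≤) = depth v∈ in d , D , ≤-trans d≤ h≤h′
    ; elim = elim ; chain = chain }
    where open ElimForest E

  emptyForest : ∀ {W} → (∀ {v} → v ∈ S → v ∉ W) → ElimForest W 0
  emptyForest W∩S=∅ = record
    { H = ⊥ ; parent = λ _ → nothing ; H⊆W = ⊥⊆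
    ; S∩W⊆H = λ v∈S v∈W → contradiction v∈W (W∩S=∅ v∈S)
    ; closed = λ _ () ; depth = λ v∈ → contradiction v∈ ∉⊥ ; elim = λ _ _ u∈ → contradiction u∈ ∉⊥
    ; chain = λ K _ _ cl → inj₁ (λ { v∈W (v∉K , u , u∈K , e) → v∉K (cl u∈K e (∈─ v∈W ∉⊥)) }) }

  module _ {H H′ : Subset (n G)} {parent parent′ : Parent} where
    private
      module F  = Forest G H parent
      module F′ = Forest G H′ parent′

    -- `parent` is arbitrary outside `H`, so the induction has to carry membership in `H` along the
    -- chain.
    Anc-embed : (∀ {v w} → v ∈ H → parent v ≡ just w → w ∈ H) →
                (∀ {v w} → v ∈ H → parent v ≡ just w → parent′ v ≡ just w) →
                ∀ {u v} → v ∈ H → F.Anc u v → F′.Anc u v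
    Anc-embed closed agree v∈ a = proj₁ (go v∈ a)
      where
      go : ∀ {u v} → v ∈ H → F.Anc u v → F′.Anc u v × u ∈ H
      go v∈ (F.par e) = F′.par (agree v∈ e) , closed v∈ e
      go v∈ (F.trans a e) with go v∈ a
      ... | a′ , u∈ = F′.trans a′ (agree u∈ e) , closed u∈ e

    Depth-embed : (∀ {v w} → v ∈ H → parent v ≡ just w → w ∈ H) →
                  (∀ {v} → v ∈ H → parent v ≡ parent′ v) →
                  ∀ {v d} → v ∈ H → F.Depth v d → F′.Depth v d
    Depth-embed closed agree v∈ (F.root e) = F′.root (trans (≡-sym (agree v∈)) e)
    Depth-embed closed agree v∈ (F.up e D) =
      F′.up (trans (≡-sym (agree v∈)) e) (Depth-embed closed agree (closed v∈ e) D)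

  module _ {H : Subset (n G)} {parent : Parent} where
    private module F = Forest G H parent

    Anc-cons : ∀ {u v w} → F.Anc u w → parent v ≡ just w → F.Anc u v
    Anc-cons (F.par f)     e = F.trans (F.par e) f
    Anc-cons (F.trans a f) e = F.trans (Anc-cons a e) f

    Anc-trans : ∀ {u v w} → F.Anc u v → F.Anc v w → F.Anc u w
    Anc-trans (F.par e)     b = F.trans b e
    Anc-trans (F.trans a e) b = F.trans (Anc-trans a b) e

    Depth-unique : ∀ {v d d′} → F.Depth v d → F.Depth v d′ → d ≡ d′
    Depth-unique (F.root e) (F.root e′)  = refl
    Depth-unique (F.root e) (F.up e′ _)  = contradiction (trans (≡-sym e) e′) (λ ())
    Depth-unique (F.up e _) (F.root e′)  = contradiction (trans (≡-sym e′) e) (λ ())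
    Depth-unique (F.up e D) (F.up e′ D′) with trans (≡-sym e) e′
    ... | refl = cong suc (Depth-unique D D′)

  module AddRoot {W : Subset (n G)} {h : ℕ} {y : V} (y∈W : y ∈ W) (E : ElimForest (W - y) h) where
    open ElimForest E

    H′ : Subset (n G)
    H′ = H ∪ ⁅ y ⁆

    parent′ : Parent
    parent′ v with v ≟ y
    ... | yes _ = nothing
    -- The default `y` applies to the former roots; the other vertices keep their parents.
    ... | no  _ = just (fromMaybe y (parent v))

    module F  = Forest G H parent
    module F′ = Forest G H′ parent′

    y∈H′ : y ∈ H′
    y∈H′ = q⊆p∪q H ⁅ y ⁆ (x∈⁅x⁆ y)

    H⊆H′ : H ⊆ H′
    H⊆H′ = p⊆p∪q ⁅ y ⁆

    ∈H⇒≢y : ∀ {v} → v ∈ H → v ≢ y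
    ∈H⇒≢y v∈ refl = x∉p-x W (H⊆W v∈)

    parent′-y : parent′ y ≡ nothing
    parent′-y with y ≟ y
    ... | yes _  = refl
    ... | no y≢y = contradiction refl y≢y

    parent′-≢y : ∀ {v} → v ≢ y → parent′ v ≡ just (fromMaybe y (parent v))
    parent′-≢y {v} v≢y with v ≟ y
    ... | yes v≡y = contradiction v≡y v≢y
    ... | no _    = refl

    parent′-just : ∀ {v w} → v ∈ H → parent v ≡ just w → parent′ v ≡ just w
    parent′-just v∈ e = trans (parent′-≢y (∈H⇒≢y v∈)) (cong (just ∘ fromMaybe y) e)

    parent′-root : ∀ {v} → v ∈ H → parent v ≡ nothing → parent′ v ≡ just y
    parent′-root v∈ e = trans (parent′-≢y (∈H⇒≢y v∈)) (cong (just ∘ fromMaybe y) e)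

    closed′ : ∀ {v w} → v ∈ H′ → parent′ v ≡ just w → w ∈ H′
    closed′ v∈ e with ∪⁅⁆⁻ v∈
    ... | inj₂ refl = contradiction (trans (≡-sym parent′-y) e) (λ ())
    ... | inj₁ v∈H  = go v∈H e (parent _) refl
      where
      go : ∀ {v w} → v ∈ H → parent′ v ≡ just w → ∀ m → parent v ≡ m → w ∈ H′
      go v∈ e nothing  eq with trans (≡-sym e) (parent′-root v∈ eq)
      ... | refl = y∈H′
      go v∈ e (just _) eq with trans (≡-sym e) (parent′-just v∈ eq)
      ... | refl = H⊆H′ (closed v∈ eq)

    Depth′ : ∀ {v d} → v ∈ H → F.Depth v d → F′.Depth v (suc d)
    Depth′ v∈ (F.root e) = F′.up (parent′-root v∈ e) (F′.root parent′-y)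
    Depth′ v∈ (F.up e D) = F′.up (parent′-just v∈ e) (Depth′ (closed v∈ e) D)

    y-above : ∀ {v} → v ∈ H → F′.Anc y v
    y-above v∈ = go v∈ (proj₁ (proj₂ (depth v∈)))
      where
      go : ∀ {v d} → v ∈ H → F.Depth v d → F′.Anc y v
      go v∈ (F.root e) = F′.par (parent′-root v∈ e)
      go v∈ (F.up e D) = Anc-cons (go (closed v∈ e) D) (parent′-just v∈ e)

    Anc′ : ∀ {u v} → v ∈ H → F.Anc u v → F′.Anc u v
    Anc′ = Anc-embed closed parent′-just

    elim′ : F′.ElimOfInduced
    elim′ u v u∈ v∈ e with ∪⁅⁆⁻ u∈ | ∪⁅⁆⁻ v∈
    ... | inj₂ refl | inj₂ refl = contradiction (trans (≡-sym e) (irref G y)) (λ ())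
    ... | inj₂ refl | inj₁ v∈H  = inj₁ (y-above v∈H)
    ... | inj₁ u∈H  | inj₂ refl = inj₂ (y-above u∈H)
    ... | inj₁ u∈H  | inj₁ v∈H  = [ inj₁ ∘ Anc′ v∈H , inj₂ ∘ Anc′ u∈H ]′ (elim u v u∈H v∈H e)

    chain′ : ∀ K → K ⊆ W ─ H′ → Connected G K → Closed (W ─ H′) K → OnChain W H′ parent′ K
    chain′ K K⊆ conn cl = go (chain K K⊆′ conn cl′)
      where
      K⊆′ : K ⊆ (W - y) ─ H
      K⊆′ v∈ = ∈─ (x∈p∧x≢y⇒x∈p-y (proj₁ (─⁻ (K⊆ v∈))) (λ { refl → proj₂ (─⁻ (K⊆ v∈)) y∈H′ }))
                  (proj₂ (─⁻ (K⊆ v∈)) ∘ H⊆H′)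
      cl′ : Closed ((W - y) ─ H) K
      cl′ u∈ e v∈ = cl u∈ e (∈─ (p─q⊆p W ⁅ y ⁆ (proj₁ (─⁻ v∈)))
        (λ v∈H′ → [ proj₂ (─⁻ v∈) , (λ { refl → x∉p-x W (proj₁ (─⁻ v∈)) }) ]′ (∪⁅⁆⁻ v∈H′)))
      go : OnChain (W - y) H parent K → OnChain W H′ parent′ K
      -- Without neighbours in `W - y`, the component can see only `y` in `W`, so `y` alone is the
      -- chain.
      go (inj₁ none) = inj₂ (y , y∈H′ , below)
        where
        below : ∀ {v} → v ∈ W → F.NbrOf K v → v ≡ y ⊎ F′.Anc v y
        below {v} v∈ nb with v ≟ y
        ... | yes v≡y = inj₁ v≡y
        ... | no  v≢y = contradiction nb (none (x∈p∧x≢y⇒x∈p-y v∈ v≢y))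
      go (inj₂ (x , x∈ , below)) = inj₂ (x , H⊆H′ x∈ , below′)
        where
        below′ : ∀ {v} → v ∈ W → F.NbrOf K v → v ≡ x ⊎ F′.Anc v x
        below′ {v} v∈ nb with v ≟ y
        ... | yes refl = inj₂ (y-above x∈)
        ... | no  v≢y  = [ inj₁ , inj₂ ∘ Anc′ x∈ ]′ (below (x∈p∧x≢y⇒x∈p-y v∈ v≢y) nb)

    addRoot : ElimForest W (suc h)
    addRoot = record
      { H = H′ ; parent = parent′
      ; H⊆W = λ v∈ → [ p─q⊆p W ⁅ y ⁆ ∘ H⊆W , (λ { refl → y∈W }) ]′ (∪⁅⁆⁻ v∈)
      ; S∩W⊆H = S∩W⊆H′
      ; closed = closed′
      ; depth = λ v∈ → [ (λ v∈H → let (d , D , d≤) = depth v∈H in suc d , Depth′ v∈H D , s≤s d≤)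
                       , (λ { refl → 1 , F′.root parent′-y , s≤s z≤n }) ]′ (∪⁅⁆⁻ v∈)
      ; elim = elim′ ; chain = chain′ }
      where
      S∩W⊆H′ : ∀ {v} → v ∈ S → v ∈ W → v ∈ H′
      S∩W⊆H′ {v} v∈S v∈W with v ≟ y
      ... | yes refl = y∈H′
      ... | no  v≢y  = H⊆H′ (S∩W⊆H v∈S (x∈p∧x≢y⇒x∈p-y v∈W v≢y))

  addRoots : ∀ {W h} m Y → ∣ Y ∣ ≤ m → ElimForest (W ─ Y) h → ElimForest W (m + h)
  addRoots {W} {h} m Y ∣Y∣≤m E with nonempty? Y
  ... | no empty = raise (m≤n+m h m)
        (subst (λ X → ElimForest X h) (trans (cong (W ─_) (Empty-unique empty)) (p─⊥≡p W)) E)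
  addRoots zero Y ∣Y∣≤m E | yes (y , y∈) = contradiction (≤-trans (x∈p⇒∣p-x∣<∣p∣ y∈) ∣Y∣≤m) (λ ())
  addRoots {W} {h} (suc m) Y ∣Y∣≤m E | yes (y , y∈) =
    subst (ElimForest W) (+-suc m h)
      (addRoots m (Y - y) (s≤s⁻¹ (≤-trans (x∈p⇒∣p-x∣<∣p∣ y∈) ∣Y∣≤m)) E′)
    where
    W─Y≡ : W ─ Y ≡ (W ─ (Y - y)) - y
    W─Y≡ = trans (cong (W ─_) (≡-sym (p-x∪⁅x⁆≡p y∈))) (≡-sym (p─q─r≡p─q∪r W (Y - y) ⁅ y ⁆))
    E″ : ElimForest ((W ─ (Y - y)) - y) h
    E″ = subst (λ X → ElimForest X h) W─Y≡ E
    E′ : ElimForest (W ─ (Y - y)) (suc h)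
    E′ with y ∈? (W ─ (Y - y))
    ... | yes y∈W = AddRoot.addRoot y∈W E″
    -- A separator need not lie inside `W`; a vertex outside costs only the height bound.
    ... | no  y∉W = raise (n≤1+n h) (subst (λ X → ElimForest X h) (p-x≡p y∉W) E″)
      where
      p-x≡p : ∀ {p : Subset (n G)} {x} → x ∉ p → p - x ≡ p
      p-x≡p {p} {x} x∉p = ⊆-antisym (p─q⊆p p ⁅ x ⁆) (λ z∈ → x∈p∧x≢y⇒x∈p-y z∈ (λ { refl → x∉p z∈ }))

  -- No edge joins `K` to the rest of `W`, so the two forests stand side by side and the height does
  -- not grow.
  module Union {W K : Subset (n G)} {h : ℕ} (K⊆W : K ⊆ W) (clK : Closed W K)
               (E₁ : ElimForest K h) (E₂ : ElimForest (W ─ K) h) where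
    module E₁ = ElimForest E₁
    module E₂ = ElimForest E₂

    H′ : Subset (n G)
    H′ = E₁.H ∪ E₂.H

    parent′ : Parent
    parent′ v = if does (v ∈? K) then E₁.parent v else E₂.parent v

    module F′ = Forest G H′ parent′

    agree₁ : ∀ {v} → v ∈ K → E₁.parent v ≡ parent′ v
    agree₁ {v} v∈ rewrite dec-true (v ∈? K) v∈ = refl

    agree₂ : ∀ {v} → v ∈ W ─ K → E₂.parent v ≡ parent′ v
    agree₂ {v} v∈ rewrite dec-false (v ∈? K) (proj₂ (─⁻ v∈)) = refl

    cl₂ : Closed W (W ─ K)
    cl₂ u∈ e v∈ = ∈─ v∈ (λ v∈K → proj₂ (─⁻ u∈) (clK v∈K (~-sym e) (proj₁ (─⁻ u∈))))

    module Part {W′ : Subset (n G)} (E : ElimForest W′ h) (W′⊆W : W′ ⊆ W) (cl : Closed W W′)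
                (agree : ∀ {v} → v ∈ W′ → ElimForest.parent E v ≡ parent′ v)
                (H⊆H′ : ElimForest.H E ⊆ H′) (H′⊆H : ∀ {v} → v ∈ W′ → v ∈ H′ → v ∈ ElimForest.H E) where
      open ElimForest E

      Anc′ : ∀ {u v} → v ∈ H → Anc u v → F′.Anc u v
      Anc′ = Anc-embed closed (λ v∈ e → trans (≡-sym (agree (H⊆W v∈))) e)

      depth′ : ∀ {v} → v ∈ H → ∃[ d ] F′.Depth v d × d ≤ h
      depth′ v∈ with depth v∈
      ... | d , D , d≤ = d , Depth-embed closed (agree ∘ H⊆W) v∈ D , d≤

      closed′ : ∀ {v w} → v ∈ H → parent′ v ≡ just w → w ∈ H′
      closed′ v∈ e = H⊆H′ (closed v∈ (trans (agree (H⊆W v∈)) e))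

      elim′ : ∀ {u v} → u ∈ H → v ∈ H′ → u ~ v → F′.Anc u v ⊎ F′.Anc v u
      elim′ u∈ v∈H′ e = [ inj₁ ∘ Anc′ v∈ , inj₂ ∘ Anc′ u∈ ]′ (elim _ _ u∈ v∈ e)
        where
        v∈ = H′⊆H (cl (H⊆W u∈) e (H′⊆W v∈H′)) v∈H′
          where
          H′⊆W : H′ ⊆ W
          H′⊆W x∈ = [ K⊆W ∘ E₁.H⊆W , p─q⊆p W K ∘ E₂.H⊆W ]′ (x∈p∪q⁻ E₁.H E₂.H x∈)

      chain′ : ∀ D → D ⊆ W ─ H′ → Connected G D → Closed (W ─ H′) D → ∀ {x} → x ∈ D → x ∈ W′ →
               OnChain W H′ parent′ D
      chain′ D D⊆ conn clD x∈D x∈W′ = finish (chain D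
        (λ v∈ → ∈─ (D⊆W′ v∈) (proj₂ (─⁻ (D⊆ v∈)) ∘ H⊆H′)) conn
        (λ u∈ e v∈ → clD u∈ e (∈─ (W′⊆W (proj₁ (─⁻ v∈))) (proj₂ (─⁻ v∈) ∘ H′⊆H (proj₁ (─⁻ v∈))))))
        where
        stay : ∀ {u v} → u ∈ W′ → R D u v → v ∈ W′
        stay u∈ (here _)      = u∈
        stay u∈ (step r e v∈) = cl (stay u∈ r) e (proj₁ (─⁻ (D⊆ v∈)))
        D⊆W′ : D ⊆ W′
        D⊆W′ v∈ = stay x∈W′ (proj₂ conn _ _ x∈D v∈)
        nbr∈ : ∀ {v} → v ∈ W → F′.NbrOf D v → v ∈ W′
        nbr∈ v∈W (_ , u , u∈D , e) = cl (D⊆W′ u∈D) e v∈W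
        finish : OnChain W′ H parent D → OnChain W H′ parent′ D
        finish (inj₁ none) = inj₁ (λ v∈ nb → none (nbr∈ v∈ nb) nb)
        finish (inj₂ (x , x∈ , below)) = inj₂ (x , H⊆H′ x∈ ,
          λ v∈ nb → [ inj₁ , inj₂ ∘ Anc′ x∈ ]′ (below (nbr∈ v∈ nb) nb))

    module P₁ = Part E₁ K⊆W clK agree₁ (p⊆p∪q E₂.H)
      (λ v∈K v∈ → [ id , (λ v∈₂ → contradiction v∈K (proj₂ (─⁻ (E₂.H⊆W v∈₂)))) ]′ (x∈p∪q⁻ E₁.H E₂.H v∈))
    module P₂ = Part E₂ (p─q⊆p W K) cl₂ agree₂ (q⊆p∪q E₁.H E₂.H)
      (λ v∈ v∈′ → [ (λ v∈₁ → contradiction (E₁.H⊆W v∈₁) (proj₂ (─⁻ v∈))) , id ]′ (x∈p∪q⁻ E₁.H E₂.H v∈′))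

    union : ElimForest W h
    union = record
      { H = H′ ; parent = parent′
      ; H⊆W = λ v∈ → [ K⊆W ∘ E₁.H⊆W , p─q⊆p W K ∘ E₂.H⊆W ]′ (x∈p∪q⁻ E₁.H E₂.H v∈)
      ; S∩W⊆H = S∩W⊆H′
      ; closed = λ v∈ e → [ (λ v∈₁ → P₁.closed′ v∈₁ e) , (λ v∈₂ → P₂.closed′ v∈₂ e) ]′ (x∈p∪q⁻ E₁.H E₂.H v∈)
      ; depth = λ v∈ → [ P₁.depth′ , P₂.depth′ ]′ (x∈p∪q⁻ E₁.H E₂.H v∈)
      ; elim = λ u v u∈ v∈ e → [ (λ u∈₁ → P₁.elim′ u∈₁ v∈ e) , (λ u∈₂ → P₂.elim′ u∈₂ v∈ e) ]′ (x∈p∪q⁻ E₁.H E₂.H u∈)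
      ; chain = chain″ }
      where
      S∩W⊆H′ : ∀ {v} → v ∈ S → v ∈ W → v ∈ H′
      S∩W⊆H′ {v} v∈S v∈W with v ∈? K
      ... | yes v∈K = p⊆p∪q E₂.H (E₁.S∩W⊆H v∈S v∈K)
      ... | no  v∉K = q⊆p∪q E₁.H E₂.H (E₂.S∩W⊆H v∈S (∈─ v∈W v∉K))
      chain″ : ∀ D → D ⊆ W ─ H′ → Connected G D → Closed (W ─ H′) D → OnChain W H′ parent′ D
      chain″ D D⊆ conn@((x , x∈) , _) clD with x ∈? K
      ... | yes x∈K = P₁.chain′ D D⊆ conn clD x∈ x∈K
      ... | no  x∉K = P₂.chain′ D D⊆ conn clD x∈ (∈─ (proj₁ (─⁻ (D⊆ x∈))) x∉K)

  module Whole {h : ℕ} (E : ElimForest ⊤ h) where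
    open ElimForest E
    module F = Forest G H parent

    height : F.HeightAtMost h
    height v d v∈ D with depth v∈
    ... | d′ , D′ , d′≤ = subst (_≤ h) (Depth-unique D′ D) d′≤

    -- The component condition asks for a leaf. Descending to a child raises the depth, which never
    -- exceeds `h`; `m` bounds the levels that remain.
    leaf-below : ∀ m {x d} → x ∈ H → F.Depth x d → h ≤ d + m → ∃[ z ] F.Leaf z × (z ≡ x ⊎ F.Anc x z)
    leaf-below m {x} {d} x∈ D h≤ with any? (λ w → (w ∈? H) ×-dec Maybe-≡-dec _≟_ (parent w) (just x))
    ... | no none = x , (x∈ , λ w w∈ e → none (w , w∈ , e)) , inj₁ refl
    leaf-below zero {x} {d} x∈ D h≤ | yes (w , w∈ , e) =
      contradiction (≤-trans (height w (suc d) w∈ (F.up e D)) (subst (h ≤_) (+-identityʳ d) h≤)) (<⇒≱ ≤-refl)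
    leaf-below (suc m) {x} {d} x∈ D h≤ | yes (w , w∈ , e)
      with leaf-below m w∈ (F.up e D) (subst (h ≤_) (+-suc d m) h≤)
    ... | z , leaf , inj₁ refl = z , leaf , inj₂ (F.par e)
    ... | z , leaf , inj₂ a    = z , leaf , inj₂ (F.trans a e)

    whole : td≤ G S h
    whole = record
      { H = H ; parent = parent ; S⊆H = λ v v∈ → S∩W⊆H v∈ ∈⊤
      ; forest = (λ v w v∈ e → closed v∈ e) , (λ v v∈ → let (d , D , _) = depth v∈ in d , D)
      ; elim = elim ; comps = comps ; height = height }
      where
      comps : F.ComponentCondition
      comps K (off , conn , cl) with chain K (λ v∈ → ∈─ ∈⊤ (off _ v∈)) conn (λ u∈ e v∈ → cl _ _ u∈ e (proj₂ (─⁻ v∈)))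
      ... | inj₁ none = inj₁ (λ v nb → none ∈⊤ nb)
      ... | inj₂ (x , x∈ , below) with leaf-below h x∈ (proj₁ (proj₂ (depth x∈))) (m≤n+m h _)
      ...   | z , leaf , inj₁ refl = inj₂ (z , leaf , λ v nb → below ∈⊤ nb)
      ...   | z , leaf , inj₂ x<z  = inj₂ (z , leaf , λ v nb →
                [ (λ { refl → inj₂ x<z }) , (λ a → inj₂ (Anc-trans a x<z)) ]′ (below ∈⊤ nb))

  -- Cutting a path along a linkage into a rooted model

  open Menger using (To; start; step; menger; Linkage)

  isArc? : Decidable₁ (λ (e : V × V) → proj₁ e ~ proj₂ e)
  isArc? (u , v) = u ~? v

  arcs : List (V × V)
  arcs = filter isArc? (cartesianProduct (allFin (n G)) (allFin (n G)))

  ∈arcs : ∀ {u v} → u ~ v → (u , v) ∈ˡ arcs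
  ∈arcs {u} {v} e = ∈-filter⁺ isArc? (∈-cartesianProduct⁺ (∈-allFin u) (∈-allFin v)) e

  arcs∈ : ∀ {u v} → (u , v) ∈ˡ arcs → u ~ v
  arcs∈ e∈ = proj₂ (∈-filter⁻ isArc? {xs = cartesianProduct (allFin (n G)) (allFin (n G))} e∈)

  reach⇒To : ∀ {X Y u v} → R (X ─ Y) u v → To arcs (_∉ Y) u v
  reach⇒To (here _)     = start
  reach⇒To (step r e _) = step (reach⇒To r) (proj₂ (─⁻ (R-target r))) (∈arcs e)

  To⇒reach : ∀ {X P u v} → (∀ {w} → P w → w ∈ X) → v ∈ X → To arcs P u v → R X u v
  To⇒reach P⊆X v∈ start         = here v∈
  To⇒reach P⊆X v∈ (step t p e∈) = step (To⇒reach P⊆X (P⊆X p) t) (arcs∈ e∈) v∈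

  -- A rooted path model under construction, extended at bag 0, which holds the current path vertex
  -- `w`. `X` bounds the area used so far, to keep new bags disjoint from it; `head` is conditional
  -- so that `m` may be 0.
  record Chain (m : ℕ) (w : V) (X : V → Set) : Set where
    field
      B        : Fin m → Subset (n G)
      disjoint : ∀ i j → i ≢ j → ∀ v → v ∈ B i → v ∉ B j
      conn     : ∀ i → Connected G (B i)
      edges    : ∀ i j → toℕ j ≡ suc (toℕ i) → ∃[ u ] ∃[ v ] (u ∈ B i × v ∈ B j × u ~ v)
      rooted   : ∀ i → ∃[ v ] (v ∈ B i × v ∈ S)
      head     : ∀ i → toℕ i ≡ 0 → w ∈ B i
      within   : ∀ i {v} → v ∈ B i → X v

  emptyChain : ∀ {w X} → Chain 0 w X
  emptyChain = record
    { B = λ () ; disjoint = λ () ; conn = λ () ; edges = λ () ; rooted = λ () ; head = λ ()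
    ; within = λ () }

  consChain : ∀ {m v w X X′ D s} → Chain m v X → (1 ≤ m → w ~ v) → w ∈ D → Connected G D → s ∈ D → s ∈ S →
              (∀ {z} → z ∈ D → ¬ X z) → (∀ {z} → z ∈ D → X′ z) → (∀ {z} → X z → X′ z) → Chain (suc m) w X′
  consChain {m} {v} {w} {D = D} {s} c w~v w∈D connD s∈D s∈S D∩X=∅ D⊆X′ X⊆X′ = record
    { B = B ; disjoint = disjoint ; conn = conn ; edges = edges ; rooted = rooted
    ; head = λ { zero _ → w∈D } ; within = λ { zero → D⊆X′ ; (suc i) → X⊆X′ ∘ c.within i } }
    where
    module c = Chain c
    B : Fin (suc m) → Subset (n G)
    B zero    = D
    B (suc i) = c.B i
    disjoint : ∀ i j → i ≢ j → ∀ v → v ∈ B i → v ∉ B j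
    disjoint zero    zero    i≢j x p q = i≢j refl
    disjoint zero    (suc j) i≢j x p q = D∩X=∅ p (c.within j q)
    disjoint (suc i) zero    i≢j x p q = D∩X=∅ q (c.within i p)
    disjoint (suc i) (suc j) i≢j x p q = c.disjoint i j (i≢j ∘ cong suc) x p q
    conn : ∀ i → Connected G (B i)
    conn zero    = connD
    conn (suc i) = c.conn i
    edges : ∀ i j → toℕ j ≡ suc (toℕ i) → ∃[ u ] ∃[ v ] (u ∈ B i × v ∈ B j × u ~ v)
    edges zero    (suc j) eq = w , v , w∈D , c.head j (suc-injective eq) , w~v (nonempty j)
      where
      nonempty : ∀ {m} → Fin m → 1 ≤ m
      nonempty zero    = s≤s z≤n
      nonempty (suc _) = s≤s z≤n
    edges (suc i) (suc j) eq = c.edges i j (suc-injective eq)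
    rooted : ∀ i → ∃[ v ] (v ∈ B i × v ∈ S)
    rooted zero    = s , s∈D , s∈S
    rooted (suc i) = c.rooted i

  growChain : ∀ {m v w X X′} → Chain m v X → v ~ w → ¬ X w → X′ w → (∀ {z} → X z → X′ z) → Chain m w X′
  growChain {zero} c v~w w∉X w∈X′ X⊆X′ = emptyChain
  growChain {suc m} {v} {w} {X} {X′} c v~w w∉X w∈X′ X⊆X′ = record
    { B = B ; disjoint = disjoint ; conn = conn ; edges = edges ; rooted = rooted
    ; head = λ { zero _ → q⊆p∪q (c.B zero) ⁅ w ⁆ (x∈⁅x⁆ w) } ; within = within }
    where
    module c = Chain c
    B : Fin (suc m) → Subset (n G)
    B zero    = c.B zero ∪ ⁅ w ⁆
    B (suc i) = c.B (suc i)
    grow : ∀ i → c.B i ⊆ B i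
    grow zero    = p⊆p∪q ⁅ w ⁆
    grow (suc i) = id
    disjoint : ∀ i j → i ≢ j → ∀ v → v ∈ B i → v ∉ B j
    disjoint zero zero i≢j x p q = i≢j refl
    disjoint zero (suc j) i≢j x p q =
      [ (λ p′ → c.disjoint zero (suc j) i≢j x p′ q) , (λ { refl → w∉X (c.within (suc j) q) }) ]′ (∪⁅⁆⁻ p)
    disjoint (suc i) zero i≢j x p q =
      [ c.disjoint (suc i) zero i≢j x p , (λ { refl → w∉X (c.within (suc i) p) }) ]′ (∪⁅⁆⁻ q)
    disjoint (suc i) (suc j) i≢j x p q = c.disjoint (suc i) (suc j) i≢j x p q
    conn : ∀ i → Connected G (B i)
    conn (suc i) = c.conn (suc i)
    conn zero = (v , v∈) , (λ x y x∈ y∈ → R-trans (R-sym (fromV x∈)) (fromV y∈))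
      where
      v∈ : v ∈ B zero
      v∈ = grow zero (c.head zero refl)
      fromV : ∀ {x} → x ∈ B zero → R (B zero) v x
      fromV x∈ with ∪⁅⁆⁻ x∈
      ... | inj₁ x∈B  = R-mono (grow zero) (proj₂ (c.conn zero) _ _ (c.head zero refl) x∈B)
      ... | inj₂ refl = step (here v∈) v~w x∈
    edges : ∀ i j → toℕ j ≡ suc (toℕ i) → ∃[ u ] ∃[ v ] (u ∈ B i × v ∈ B j × u ~ v)
    edges i j eq with c.edges i j eq
    ... | x , y , x∈ , y∈ , e = x , y , grow i x∈ , grow j y∈ , e
    rooted : ∀ i → ∃[ v ] (v ∈ B i × v ∈ S)
    rooted i with c.rooted i
    ... | s , s∈B , s∈S = s , grow i s∈B , s∈S
    within : ∀ i {z} → z ∈ B i → X′ z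
    within zero    z∈ = [ X⊆X′ ∘ c.within zero , (λ { refl → w∈X′ }) ]′ (∪⁅⁆⁻ z∈)
    within (suc i) z∈ = X⊆X′ (c.within (suc i) z∈)

  module Assemble {Z₀ : Subset (n G)} {ℓ : ℕ} (L : Linkage arcs Z₀ S ℓ) where
    open Linkage L

    leg-conn : ∀ {a} → a ∈ starts → Connected G (leg a)
    leg-conn {a} a∈ = (a , a∈leg a∈) , λ x y x∈ y∈ → R-trans (R-sym (fromA x∈)) (fromA y∈)
      where
      fromA : ∀ {x} → x ∈ leg a → R (leg a) a x
      fromA x∈ = To⇒reach proj₁ x∈ (pre a∈ x∈)

    Area : Subset (n G) → Subset (n G) → V → Set
    Area Z T z = z ∈ Z ⊎ (∃[ a ] a ∈ T × z ∈ leg a)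

    -- The linkage starts from the path itself, so by `onlyA` a leg meets the path in its start
    -- only.
    leg-fresh : ∀ {Z T w} → Z ⊆ Z₀ → T ⊆ starts → w ∈ starts → w ∉ Z → w ∉ T → ∀ {z} → z ∈ leg w → ¬ Area Z T z
    leg-fresh {Z} Z⊆ T⊆ w∈ w∉Z w∉T z∈ (inj₁ z∈Z) = w∉Z (subst (_∈ Z) (onlyA w∈ z∈ (Z⊆ z∈Z)) z∈Z)
    leg-fresh {T = T} Z⊆ T⊆ w∈ w∉Z w∉T z∈ (inj₂ (a , a∈T , z∈a)) =
      w∉T (subst (_∈ T) (disjoint (T⊆ a∈T) w∈ z∈a z∈) a∈T)

    ∣p∣≤1+∣p-x∣ : ∀ {p : Subset (n G)} {x} → x ∈ p → ∣ p ∣ ≤ suc ∣ p - x ∣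
    ∣p∣≤1+∣p-x∣ {p} {x} x∈ = subst (λ q → ∣ q ∣ ≤ suc ∣ p - x ∣) (p-x∪⁅x⁆≡p x∈) (∣p∪⁅x⁆∣≤1+∣p∣ (p - x) x)

    -- Along the path, a start in `T` opens a bag with its leg, and any other vertex joins the
    -- newest bag. Once `m` has dropped to 0, the remaining initial part of the path is discarded.
    cut : ∀ {u w Z T} m → Path u w Z → Z ⊆ Z₀ → T ⊆ starts → T ⊆ Z → m ≤ ∣ T ∣ → Chain m w (Area Z T)
    cut zero p Z⊆ T⊆s T⊆Z m≤ = emptyChain
    cut {u} {T = T} (suc m) single Z⊆ T⊆s T⊆Z m≤ with u ∈? T
    ... | no u∉ = contradiction (≤-trans m≤ (subst (∣ T ∣ ≤_) (∣⊥∣≡0 (n G)) (p⊆q⇒∣p∣≤∣q∣ T⊆⊥))) (λ ())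
      where
      T⊆⊥ : T ⊆ ⊥
      T⊆⊥ x∈ = contradiction (subst (_∈ T) (x∈⁅y⁆⇒x≡y u (T⊆Z x∈)) x∈) u∉
    cut {u} {T = T} (suc m) single Z⊆ T⊆s T⊆Z m≤ | yes u∈ =
      consChain {m = m} {v = u} {X = Area ⊥ ⊥} (noMore m m≤0) (λ 1≤m → contradiction (≤-trans 1≤m m≤0) (λ ()))
        (a∈leg u∈s) (leg-conn u∈s) (end∈leg u∈s) (end∈B u∈s)
        (leg-fresh {⊥} {⊥} (λ x∈ → contradiction x∈ ∉⊥) (λ x∈ → contradiction x∈ ∉⊥) u∈s ∉⊥ ∉⊥)
        (λ z∈ → inj₂ (u , u∈ , z∈))
        (λ { (inj₁ z∈) → contradiction z∈ ∉⊥ ; (inj₂ (_ , a∈ , _)) → contradiction a∈ ∉⊥ })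
      where
      u∈s = T⊆s u∈
      m≤0 : m ≤ 0
      m≤0 = ≤-trans (s≤s⁻¹ (≤-trans m≤ (∣p∣≤1+∣p-x∣ u∈)))
        (subst (∣ T - u ∣ ≤_) (∣⊥∣≡0 (n G)) (p⊆q⇒∣p∣≤∣q∣ T-u⊆⊥))
        where
        T-u⊆⊥ : T - u ⊆ ⊥
        T-u⊆⊥ x∈ = contradiction (T⊆Z (p─q⊆p T ⁅ u ⁆ x∈)) (x∈p─q⇒x∉q T ⁅ u ⁆ x∈)
      noMore : ∀ m → m ≤ 0 → ∀ {X} → Chain m u X
      noMore zero _ = emptyChain
    cut {T = T} (suc m) (snoc {v} {w} {Z} p e w∉) Z⊆ T⊆s T⊆Z m≤ with w ∈? T
    ... | no w∉T = growChain (cut (suc m) p (Z⊆ ∘ p⊆p∪q ⁅ w ⁆) T⊆s T⊆Z′ m≤) e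
        (λ { (inj₁ w∈Z) → w∉ w∈Z
           ; (inj₂ (a , a∈ , w∈a)) → w∉T (subst (_∈ T) (≡-sym (onlyA (T⊆s a∈) w∈a (Z⊆ (q⊆p∪q Z ⁅ w ⁆ (x∈⁅x⁆ w))))) a∈) })
        (inj₁ (q⊆p∪q Z ⁅ w ⁆ (x∈⁅x⁆ w)))
        (λ { (inj₁ z∈) → inj₁ (p⊆p∪q ⁅ w ⁆ z∈) ; (inj₂ r) → inj₂ r })
      where
      T⊆Z′ : T ⊆ Z
      T⊆Z′ x∈ = [ id , (λ { refl → contradiction x∈ w∉T }) ]′ (∪⁅⁆⁻ (T⊆Z x∈))
    ... | yes w∈T = consChain
        (cut m p (Z⊆ ∘ p⊆p∪q ⁅ w ⁆) (T⊆s ∘ p─q⊆p T ⁅ w ⁆) T-w⊆Z (s≤s⁻¹ (≤-trans m≤ (∣p∣≤1+∣p-x∣ w∈T))))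
        (λ _ → ~-sym e) (a∈leg w∈s) (leg-conn w∈s) (end∈leg w∈s) (end∈B w∈s)
        (leg-fresh (Z⊆ ∘ p⊆p∪q ⁅ w ⁆) (T⊆s ∘ p─q⊆p T ⁅ w ⁆) w∈s w∉ (x∉p-x T))
        (λ z∈ → inj₂ (w , w∈T , z∈))
        (λ { (inj₁ z∈) → inj₁ (p⊆p∪q ⁅ w ⁆ z∈) ; (inj₂ (a , a∈ , z∈)) → inj₂ (a , p─q⊆p T ⁅ w ⁆ a∈ , z∈) })
      where
      w∈s = T⊆s w∈T
      T-w⊆Z : T - w ⊆ Z
      T-w⊆Z x∈ = [ id , (λ { refl → contradiction x∈ (x∉p-x T) }) ]′ (∪⁅⁆⁻ (T⊆Z (p─q⊆p T ⁅ w ⁆ x∈)))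

    rootedModel : ∀ {u v} → Path u v Z₀ → RootedPathModel G S ℓ
    rootedModel p = record
      { B = c.B ; disjoint = c.disjoint ; conn = c.conn ; edges = c.edges ; rooted = c.rooted }
      where module c = Chain (cut ℓ p id id starts⊆A size)

  ⊤-flat : ∀ {k} → ¬ RootedPathModel G S (suc k) → Flat k ⊤
  ⊤-flat {k} noModel {Z = Z} p _ with menger arcs Z S (suc k)
  ... | inj₂ L = contradiction (Assemble.rootedModel L p) noModel
  ... | inj₁ (Y , ∣Y∣≤k , sep) = Y , s≤s⁻¹ ∣Y∣≤k , λ z s z∈ s∈ r → proj₂ (─⁻ (R-target r)) (sep z∈ s∈ (reach⇒To r))

  -- The recursion and its height

  -- Pascal's rule: a separator of `suc k` vertices put on top accounts for one step between
  -- consecutive binomials.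
  [2+k]C2≡ : ∀ k → suc k + (suc k C 2) ≡ suc (suc k) C 2
  [2+k]C2≡ k = trans (cong (_+ (suc k C 2)) (≡-sym (nC1≡n (suc k)))) (nCk+nC[k+1]≡[n+1]C[k+1] (suc k) 1)

  -- Separators are found only in connected sets; since components share the height bound, only the
  -- separators along one branch add up.
  byComponents : ∀ {k h} → (∀ {K w} → w ∈ K → Conn K → Flat k K → ElimForest K h) →
                 ∀ m {W} → ∣ W ∣ ≤ m → Flat k W → ElimForest W h
  byComponents onConn m {W} ∣W∣≤m flat with nonempty? W
  ... | no empty = raise z≤n (emptyForest (λ _ v∈ → empty (_ , v∈)))
  byComponents onConn zero ∣W∣≤m flat | yes (w , w∈) =
    contradiction (≤-trans (x∈p⇒∣p-x∣<∣p∣ w∈) ∣W∣≤m) (λ ())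
  byComponents onConn (suc m) {W} ∣W∣≤m flat | yes (w , w∈) = Union.union K⊆W comp-closed
    (onConn w∈K comp-conn (Flat-mono K⊆W flat))
    (byComponents onConn m
      (s≤s⁻¹ (≤-trans (p∩q≢∅⇒∣p─q∣<∣p∣ W (comp W w) (w , x∈p∩q⁺ (w∈ , w∈K))) ∣W∣≤m))
      (Flat-mono (p─q⊆p W (comp W w)) flat))
    where
    K⊆W : comp W w ⊆ W
    K⊆W = comp⊆
    w∈K : w ∈ comp W w
    w∈K = ∈comp⁺ (here w∈)

  removeSeparator : ∀ {k h K w} → (∀ {W} → Flat k W → ElimForest W h) →
                    w ∈ K → Conn K → Flat (suc k) K → ElimForest K (suc k + h)
  removeSeparator {k} solve w∈ conn flat =
    let Y , ∣Y∣≤ , flatY = flat-separator flat conn w∈ in addRoots (suc k) Y ∣Y∣≤ (solve flatY)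

  Flat-0⇒S-free : ∀ {W} → Flat 0 W → ∀ {s} → s ∈ S → s ∉ W
  Flat-0⇒S-free {W} flat {s} s∈S s∈W with flat (single {s}) (λ z∈ → subst (_∈ W) (≡-sym (x∈⁅y⁆⇒x≡y s z∈)) s∈W)
  -- The path consisting of `s` alone already reaches `S`, and an empty separator cannot remove it.
  ... | Y , ∣Y∣≤0 , sep = sep s s (x∈⁅x⁆ s) s∈S (here (∈─ s∈W
        (λ s∈Y → contradiction (≤-trans (x∈p⇒∣p-x∣<∣p∣ s∈Y) ∣Y∣≤0) (λ ()))))

  flat⇒elimForest : ∀ k {W} → Flat k W → ElimForest W (suc k C 2)
  -- `1 C 2` computes to 0, the height of the empty forest.
  flat⇒elimForest zero    flat = emptyForest (Flat-0⇒S-free flat)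
  flat⇒elimForest (suc k) {W} flat = subst (ElimForest W) ([2+k]C2≡ k)
    (byComponents (removeSeparator (flat⇒elimForest k)) ∣ W ∣ ≤-refl flat)

  noModel⇒td≤ : ∀ k → ¬ RootedPathModel G S (suc k) → td≤ G S (suc k C 2)
  noModel⇒td≤ k noModel = Whole.whole (flat⇒elimForest k (⊤-flat noModel))

theorem3p1 : (ℓ : ℕ) → 1 ≤ ℓ → (G : Graph) → (S : Subset (n G)) →
    ¬ RootedPathModel G S ℓ → td≤ G S (ℓ C 2)
theorem3p1 (suc k) _ G S noModel = noModel⇒td≤ G S k noModel
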